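{- Let $q$ be a power of an odd prime, let $d\geq 2$ and let $\mathcal{A}\subseteq\mathbb{F}_q$. Then \[ \sum_{l\in\mathbb{F}_q^{*}}N_d^2(\mathcal{A};l)\leq (1+o(1))\frac{|\mathcal{A}|^{2d^2}}{q}+q^{d-1}|\mathcal{A}|^{2d}(1+o(1))\sum_{t\in\mathbb{F}_q^{*}}N_{d-1}^2(\mathcal{A};t). \]
   Context: $\mathbb{F}_q$ is the finite field with $q$ elements. For a set $\mathcal{A}\subseteq\mathbb{F}_q$, an integer $k\ge1$ and $t\in\mathbb{F}_q$, $N_k(\mathcal{A};t)$ denotes the number of $k\times k$ matrices with all entries in $\mathcal{A}$ whose determinant equals $t$ (for $k=1$ this is $1$ if $t\in\mathcal{A}$ and $0$ otherwise). Here $o(1)$ denotes a quantity tending to $0$ as $|\mathcal{A}|\to\infty$, with $d$ fixed. -}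

module Defs where

open import Data.Nat using (ℕ; zero; suc)
import Data.Nat
import Data.List
import Data.Nat.ListAction
open import Data.Fin using (Fin; zero; suc)
open import Data.Fin.Subset using (Subset; _∈_)
open import Data.Fin.Subset.Properties using (_∈?_)
open import Data.Fin.Properties using () renaming (_≟_ to _≟ᶠ_)
open import Data.List using (List; []; _∷_; map; concatMap; filter; length; allFin)
open import Data.Product using (Σ; _×_; ∃)
open import Relation.Nullary using (¬_; Dec; yes; no; ¬?)
open import Relation.Binary.PropositionalEquality using (_≡_)
open import Algebra.Structures using (IsCommutativeRing)

-- A finite field with q elements, presented (up to isomorphism) as a field
-- structure on the carrier Fin q with propositional equality.
record FiniteField (q : ℕ) : Set where
  field
    _+_ _*_ : Fin q → Fin q → Fin q
    -_      : Fin q → Fin q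
    0# 1#   : Fin q
    isCommutativeRing : IsCommutativeRing _≡_ _+_ _*_ -_ 0# 1#
    0≢1     : ¬ (0# ≡ 1#)
    inverse : (x : Fin q) → ¬ (x ≡ 0#) → Σ (Fin q) (λ y → x * y ≡ 1#)

allFuns : {X : Set} (n : ℕ) → List X → List (Fin n → X)
allFuns zero    xs = (λ ()) ∷ []
allFuns (suc n) xs =
  concatMap (λ x → map (λ f → λ { zero → x ; (suc i) → f i }) (allFuns n xs)) xs

module _ {q : ℕ} (F : FiniteField q) where
  open FiniteField F

  sumF : (n : ℕ) → (Fin n → Fin q) → Fin q
  sumF zero    f = 0#
  sumF (suc n) f = f zero + sumF n (λ i → f (suc i))

  altSum : (n : ℕ) → (Fin n → Fin q) → Fin q
  altSum zero    f = 0#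
  altSum (suc n) f = f zero + (- altSum n (λ i → f (suc i)))

  punch : {n : ℕ} → Fin (suc n) → Fin n → Fin (suc n)
  punch zero    i       = suc i
  punch (suc j) zero    = zero
  punch (suc j) (suc i) = suc (punch j i)

  det : (n : ℕ) → (Fin n → Fin n → Fin q) → Fin q
  det zero    M = 1#
  det (suc n) M =
    altSum (suc n) (λ j → M zero j * det n (λ r c → M (suc r) (punch j c)))

  elems : Subset q → List (Fin q)
  elems A = filter (λ x → x ∈? A) (allFin q)

  N : (k : ℕ) → Subset q → Fin q → ℕ
  N k A t = length (filter (λ M → det k M ≟ᶠ t) (allFuns k (allFuns k (elems A))))

  units : List (Fin q)
  units = filter (λ x → ¬? (x ≟ᶠ 0#)) (allFin q)

  sumSqN : (k : ℕ) → Subset q → ℕ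
  sumSqN k A = Data.Nat.ListAction.sum (map (λ t → N k A t Data.Nat.* N k A t) units)

open import Data.Integer using (+_)
open import Data.Rational using (ℚ; _/_)

ℕ→ℚ : ℕ → ℚ
ℕ→ℚ n = (+ n) / 1

-- Expanding a determinant along its first row a writes it as a · v, where v is the cofactor vector
-- of the remaining rows; write P for the number of non-zero a ∈ A^d and T for the number of choices
-- of the remaining rows with v ≠ 0.  For l ≠ 0 the equation a · v = l says (l⁻¹ a) · v = 1.  Since
-- a non-zero b equals l⁻¹ a for at most |A| pairs (a , l), Cauchy–Schwarz bounds
-- ∑ₗ (N_d(l) − P T / q)² by P |A| times the variance over b ∈ F_q^d of the number of v with
-- b · v = 1, and that variance is at most q^(d−1) E, where E counts pairs of submatrices with the
-- same non-zero cofactor vector v.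
--
-- As v is orthogonal to every row, a non-zero coordinate vⱼ makes column j of a submatrix a function
-- of v and the other columns, so the pairs with v₀ ≠ 0 contribute at most |A|^(d−1) ∑ₜ N_{d−1}(t)².
-- If v₀ = 0 but vⱼ ≠ 0, then column j lies in the span of d − 2 others, hence in a hyperplane, and
-- the contribution is smaller by a factor |A|.
module Submission where

open import Level using (0ℓ)
open import Defs
open import Data.Nat using (ℕ; zero; suc; _*_; _^_; NonZero)
import Data.Nat.Properties as ℕ
open import Data.Nat.Tactic.RingSolver using (solve-∀)
open import Data.Bool using (true; false)
open import Data.Fin as Fin using (Fin; zero; suc; inject₁)
open import Data.Fin.Properties using () renaming (_≟_ to _≟ᶠ_)
open import Data.Fin.Subset using (Subset; ∣_∣)
open import Data.Fin.Subset.Properties using (_∈?_; drop-there; ∣p∣≤n)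
open import Data.List using (List; []; _∷_; _++_; map; concatMap; filter; length; allFin; cartesianProductWith)
open import Data.List.Properties using (length-tabulate; length-map; length-filter; map-tabulate)
open import Data.List.Membership.Propositional using (_∈_)
open import Data.List.Membership.Propositional.Properties
  using (∈-allFin; ∈-filter⁺; ∈-filter⁻; ∈-cartesianProductWith⁺; ∈-cartesianProductWith⁻)
open import Data.List.Relation.Binary.Pointwise as Pointwise using (Pointwise; []; _∷_)
open import Data.List.Relation.Unary.All as All using ([]; _∷_)
open import Data.List.Relation.Unary.AllPairs using ([]; _∷_)
open import Data.List.Relation.Unary.Any as Any using (any?; here; there)
open import Data.List.Relation.Unary.Unique.Propositional using (Unique)
import Data.List.Relation.Unary.Unique.Propositional.Properties as Unique
open import Data.Product using (Σ; ∃; _×_; _,_; proj₁; proj₂)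
open import Data.Rational as ℚ using (ℚ; mkℚ; 0ℚ; 1ℚ; _/_; toℚᵘ)
import Data.Rational.Properties as ℚ
open import Data.Rational.Solver using (module +-*-Solver)
open import Data.Rational.Unnormalised as ℚᵘ using (mkℚᵘ)
import Data.Rational.Unnormalised.Properties as ℚᵘ
open import Data.Sum using (inj₁; inj₂)
open import Data.Empty using (⊥-elim)
open import Data.Vec as Vec using (Vec; []; _∷_; lookup; insertAt; removeAt; zipWith; tabulate; tail; here; there)
open import Data.Vec.Functional using () renaming (_∷_ to _◂_)
open import Data.Vec.Properties
  using (≡-dec; ∷-injective; lookup∘tabulate; lookup-map; lookup-replicate; lookup-zipWith; insertAt-removeAt)
open import Function using (_∘_; id)
open import Relation.Nullary using (¬_; Dec; yes; no; ¬?)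
open import Relation.Nullary.Decidable using (_×-dec_; decidable-stable)
open import Relation.Unary using (Pred; Decidable)
open import Relation.Binary.PropositionalEquality
open import Algebra.Bundles using (CommutativeRing)
import Algebra.Properties.Ring as RingProperties

-- Three choices keep both constants at 1 + o(1). Scaling the right-hand side to 1 makes distinct
-- proportional vectors incompatible: no b satisfies b · v = 1 and b · v′ = 1 for v′ = c v with c ≠
-- 1. So E counts equal cofactor vectors and not merely proportional ones, and equal cofactor
-- vectors have equal minors, which is what a sum of squares over t counts. The zero row is
-- discarded because every l would send it to the same b = 0. Finally, one uniform bound for all d
-- possible pivot coordinates of v would cost a factor d, so v₀ is the preferred pivot and the
-- others are used only when v₀ = 0.
--
-- The errors are explicit. The sum over the q - 1 units, with the total of N_d bounded by P T,
-- gives 1 + 1/q; the pairs with v₀ = 0 give 1 + (d - 1)/|A|. As |A| ≤ q, both errors are at most (d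
-- - 1)/|A|.
--
-- All estimates are made between natural numbers: deviations are multiplied by q, and the cross
-- term of a square is moved to the other side instead of being subtracted.

-- Sums over lists, indicators, and enumerations of vectors

module Sums where
  open import Data.Nat using (_+_; _≤_; _<_; z≤n; s≤s; ∣_-_∣)
  open import Data.Nat.Properties
  open import Data.Nat.ListAction using (sum)

  private variable
    X Y Z : Set
    P Q : Set

  ∑ : List X → (X → ℕ) → ℕ
  ∑ xs f = sum (map f xs)

  syntax ∑ xs (λ x → e) = ∑[ x ← xs ] e

  ∑-cong∈ : (xs : List X) {f g : X → ℕ} → (∀ {x} → x ∈ xs → f x ≡ g x) → ∑ xs f ≡ ∑ xs g
  ∑-cong∈ []       f≡g = refl
  ∑-cong∈ (x ∷ xs) f≡g = cong₂ _+_ (f≡g (here refl)) (∑-cong∈ xs (f≡g ∘ there))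

  ∑-cong : (xs : List X) {f g : X → ℕ} → (∀ x → f x ≡ g x) → ∑ xs f ≡ ∑ xs g
  ∑-cong xs f≡g = ∑-cong∈ xs (λ {x} _ → f≡g x)

  ∑-mono∈ : (xs : List X) {f g : X → ℕ} → (∀ {x} → x ∈ xs → f x ≤ g x) → ∑ xs f ≤ ∑ xs g
  ∑-mono∈ []       f≤g = z≤n
  ∑-mono∈ (x ∷ xs) f≤g = +-mono-≤ (f≤g (here refl)) (∑-mono∈ xs (f≤g ∘ there))

  ∑-mono : (xs : List X) {f g : X → ℕ} → (∀ x → f x ≤ g x) → ∑ xs f ≤ ∑ xs g
  ∑-mono xs f≤g = ∑-mono∈ xs (λ {x} _ → f≤g x)

  ∑-const : (xs : List X) (c : ℕ) → ∑[ _ ← xs ] c ≡ length xs * c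
  ∑-const []       c = refl
  ∑-const (x ∷ xs) c = cong (c +_) (∑-const xs c)

  ∑-+ : (xs : List X) (f g : X → ℕ) → ∑[ x ← xs ] (f x + g x) ≡ ∑ xs f + ∑ xs g
  ∑-+ []       f g = refl
  ∑-+ (x ∷ xs) f g rewrite ∑-+ xs f g = interchange (f x) (g x) (∑ xs f) (∑ xs g)
    where
    interchange : ∀ a b c d → a + b + (c + d) ≡ a + c + (b + d)
    interchange = solve-∀

  ∑-*ˡ : (xs : List X) (c : ℕ) (f : X → ℕ) → ∑[ x ← xs ] (c * f x) ≡ c * ∑ xs f
  ∑-*ˡ []       c f = sym (*-zeroʳ c)
  ∑-*ˡ (x ∷ xs) c f = trans (cong (c * f x +_) (∑-*ˡ xs c f)) (sym (*-distribˡ-+ c (f x) (∑ xs f)))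

  ∑-*ʳ : (xs : List X) (f : X → ℕ) (c : ℕ) → ∑[ x ← xs ] (f x * c) ≡ ∑ xs f * c
  ∑-*ʳ xs f c = trans (∑-cong xs (λ x → *-comm (f x) c)) (trans (∑-*ˡ xs c f) (*-comm c (∑ xs f)))

  ∑-swap : (xs : List X) (ys : List Y) (f : X → Y → ℕ) →
    ∑[ x ← xs ] ∑[ y ← ys ] f x y ≡ ∑[ y ← ys ] ∑[ x ← xs ] f x y
  ∑-swap []       ys f = sym (trans (∑-const ys 0) (*-zeroʳ (length ys)))
  ∑-swap (x ∷ xs) ys f =
    trans (cong (∑ ys (f x) +_) (∑-swap xs ys f))
          (sym (∑-+ ys (f x) (λ y → ∑[ x ← xs ] f x y)))

  ∑-product : (xs : List X) (ys : List Y) (f : X → ℕ) (g : Y → ℕ) →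
    ∑[ x ← xs ] ∑[ y ← ys ] (f x * g y) ≡ ∑ xs f * ∑ ys g
  ∑-product xs ys f g = trans (∑-cong xs (λ x → ∑-*ˡ ys (f x) g)) (∑-*ʳ xs f (∑ ys g))

  ∑-++ : (xs ys : List X) (f : X → ℕ) → ∑ (xs ++ ys) f ≡ ∑ xs f + ∑ ys f
  ∑-++ []       ys f = refl
  ∑-++ (x ∷ xs) ys f = trans (cong (f x +_) (∑-++ xs ys f)) (sym (+-assoc (f x) _ _))

  ∑-map : (h : X → Y) (xs : List X) (f : Y → ℕ) → ∑ (map h xs) f ≡ ∑ xs (f ∘ h)
  ∑-map h []       f = refl
  ∑-map h (x ∷ xs) f = cong (f (h x) +_) (∑-map h xs f)

  ∑-cartesianProductWith : (h : X → Y → Z) (xs : List X) (ys : List Y) (f : Z → ℕ) →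
    ∑ (cartesianProductWith h xs ys) f ≡ ∑[ x ← xs ] ∑[ y ← ys ] f (h x y)
  ∑-cartesianProductWith h []       ys f = refl
  ∑-cartesianProductWith h (x ∷ xs) ys f =
    trans (∑-++ (map (h x) ys) _ f) (cong₂ _+_ (∑-map (h x) ys f) (∑-cartesianProductWith h xs ys f))

  𝟙 : Dec P → ℕ
  𝟙 (yes _) = 1
  𝟙 (no  _) = 0

  𝟙-yes : (p : Dec P) → P → 𝟙 p ≡ 1
  𝟙-yes (yes _)  _  = refl
  𝟙-yes (no ¬p)  p  = ⊥-elim (¬p p)

  𝟙-no : (p : Dec P) → ¬ P → 𝟙 p ≡ 0
  𝟙-no (yes p) ¬p = ⊥-elim (¬p p)
  𝟙-no (no _)  _  = refl

  𝟙-elim : (p : Dec P) {m : ℕ} → (P → 1 ≤ m) → 𝟙 p ≤ m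
  𝟙-elim (yes p) h = h p
  𝟙-elim (no _)  h = z≤n

  𝟙-mono : (p : Dec P) (q : Dec Q) → (P → Q) → 𝟙 p ≤ 𝟙 q
  𝟙-mono p q h = 𝟙-elim p (λ x → ≤-reflexive (sym (𝟙-yes q (h x))))

  𝟙-cong : (p : Dec P) (q : Dec Q) → (P → Q) → (Q → P) → 𝟙 p ≡ 𝟙 q
  𝟙-cong p q h k = ≤-antisym (𝟙-mono p q h) (𝟙-mono q p k)

  -- Pulls a condition out of an inner count m: if m is positive, a counted object exists, and P is
  -- read off from it.
  ≤-𝟙-* : (p : Dec P) {m n : ℕ} → (1 ≤ m → P) → (P → m ≤ n) → m ≤ 𝟙 p * n
  ≤-𝟙-* (yes p) {m} {n} _ h = ≤-trans (h p) (≤-reflexive (sym (+-identityʳ n)))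
  ≤-𝟙-* (no ¬p) {zero}  w h = z≤n
  ≤-𝟙-* (no ¬p) {suc m} w h = ⊥-elim (¬p (w (s≤s z≤n)))

  ∑-filter : {R : Pred X _} (R? : Decidable R) (xs : List X) (f : X → ℕ) →
    ∑ (filter R? xs) f ≡ ∑[ x ← xs ] (𝟙 (R? x) * f x)
  ∑-filter R? []       f = refl
  ∑-filter R? (x ∷ xs) f with R? x
  ... | yes _ = cong₂ _+_ (sym (+-identityʳ (f x))) (∑-filter R? xs f)
  ... | no _  = ∑-filter R? xs f

  length-filter-∑ : {R : Pred X _} (R? : Decidable R) (xs : List X) →
    length (filter R? xs) ≡ ∑[ x ← xs ] 𝟙 (R? x)
  length-filter-∑ R? []       = refl
  length-filter-∑ R? (x ∷ xs) with R? x
  ... | yes _ = cong suc (length-filter-∑ R? xs)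
  ... | no _  = length-filter-∑ R? xs

  ∑-zero : (xs : List X) {f : X → ℕ} → (∀ {x} → x ∈ xs → f x ≡ 0) → ∑ xs f ≡ 0
  ∑-zero xs f≡0 = trans (∑-cong∈ xs f≡0) (trans (∑-const xs 0) (*-zeroʳ (length xs)))

  ∑-≤-length : (xs : List X) {f : X → ℕ} {c : ℕ} → (∀ {x} → x ∈ xs → f x ≤ c) → ∑ xs f ≤ length xs * c
  ∑-≤-length xs {c = c} f≤c = ≤-trans (∑-mono∈ xs f≤c) (≤-reflexive (∑-const xs c))

  term≤∑ : (xs : List X) (f : X → ℕ) {x : X} → x ∈ xs → f x ≤ ∑ xs f
  term≤∑ (x ∷ xs) f (here refl) = m≤m+n (f x) _
  term≤∑ (y ∷ xs) f (there x∈)  = ≤-trans (term≤∑ xs f x∈) (m≤n+m _ (f y))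

  ∑𝟙≤1 : {R : Pred X _} (R? : Decidable R) {xs : List X} → Unique xs →
    (∀ {x y} → x ∈ xs → y ∈ xs → R x → R y → x ≡ y) → ∑[ x ← xs ] 𝟙 (R? x) ≤ 1
  ∑𝟙≤1 R? {[]}     []          h = z≤n
  ∑𝟙≤1 R? {x ∷ xs} (x∉ ∷ uniq) h with R? x
  ... | no  _  = ∑𝟙≤1 R? uniq (λ x∈ y∈ → h (there x∈) (there y∈))
  ... | yes rx = s≤s (≤-reflexive (∑-zero xs λ {y} y∈ → 𝟙-no (R? y) λ ry →
                   All.lookup x∉ y∈ (h (here refl) (there y∈) rx ry)))

  ∑𝟙≡1 : {R : Pred X _} (R? : Decidable R) {xs : List X} → Unique xs →
    (∀ {x y} → x ∈ xs → y ∈ xs → R x → R y → x ≡ y) → ∀ {x} → x ∈ xs → R x → ∑[ x ← xs ] 𝟙 (R? x) ≡ 1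
  ∑𝟙≡1 R? {xs} uniq h {x} x∈ rx = ≤-antisym (∑𝟙≤1 R? uniq h)
    (≤-trans (≤-reflexive (sym (𝟙-yes (R? x) rx))) (term≤∑ xs (λ y → 𝟙 (R? y)) x∈))

  ∑𝟙-witness : {R : Pred X _} (R? : Decidable R) (xs : List X) →
    1 ≤ ∑[ x ← xs ] 𝟙 (R? x) → ∃ λ x → x ∈ xs × R x
  ∑𝟙-witness R? (x ∷ xs) h with R? x
  ... | yes rx = x , here refl , rx
  ... | no _ with ∑𝟙-witness R? xs h
  ...   | y , y∈ , ry = y , there y∈ , ry

  -- Read from right to left, it introduces a sum over the possible values of y; after a swap of
  -- sums this groups terms by fibres.
  ∑-δ : (_≟_ : (x y : X) → Dec (x ≡ y)) {xs : List X} → Unique xs → ∀ {y} → y ∈ xs →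
    (f : X → ℕ) → ∑[ x ← xs ] (𝟙 (y ≟ x) * f x) ≡ f y
  ∑-δ _≟_ {xs} uniq {y} y∈ f =
    trans (∑-cong xs step) (trans (∑-*ʳ xs (λ x → 𝟙 (y ≟ x)) (f y))
      (trans (cong (_* f y) (∑𝟙≡1 (y ≟_) uniq (λ _ _ p q → trans (sym p) q) y∈ refl)) (*-identityˡ (f y))))
    where
    step : ∀ x → 𝟙 (y ≟ x) * f x ≡ 𝟙 (y ≟ x) * f y
    step x with y ≟ x
    ... | yes refl = refl
    ... | no _     = refl

  -- Vectors replace the functions of `allFuns` because they have decidable equality, and equality
  -- of vectors can be proved entry by entry; counts based on uniqueness need both.
  allVecs : (n : ℕ) → List X → List (Vec X n)
  allVecs zero    xs = [] ∷ []
  allVecs (suc n) xs = cartesianProductWith _∷_ xs (allVecs n xs)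

  ∑-allVecs-suc : (n : ℕ) (xs : List X) (f : Vec X (suc n) → ℕ) →
    ∑ (allVecs (suc n) xs) f ≡ ∑[ x ← xs ] ∑[ v ← allVecs n xs ] f (x ∷ v)
  ∑-allVecs-suc n xs f = ∑-cartesianProductWith _∷_ xs (allVecs n xs) f

  length≡∑1 : (xs : List X) → length xs ≡ ∑[ _ ← xs ] 1
  length≡∑1 xs = sym (trans (∑-const xs 1) (*-identityʳ (length xs)))

  length-allVecs : (n : ℕ) (xs : List X) → length (allVecs n xs) ≡ length xs ^ n
  length-allVecs zero    xs = refl
  length-allVecs (suc n) xs = begin
    length (allVecs (suc n) xs)          ≡⟨ length≡∑1 (allVecs (suc n) xs) ⟩
    ∑[ _ ← allVecs (suc n) xs ] 1        ≡⟨ ∑-allVecs-suc n xs (λ _ → 1) ⟩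
    ∑[ _ ← xs ] ∑[ _ ← allVecs n xs ] 1  ≡⟨ ∑-const xs _ ⟩
    length xs * (∑[ _ ← allVecs n xs ] 1) ≡⟨ cong (length xs *_) (trans (sym (length≡∑1 (allVecs n xs))) (length-allVecs n xs)) ⟩
    length xs * length xs ^ n            ∎
    where open ≡-Reasoning

  allVecs-unique : (n : ℕ) {xs : List X} → Unique xs → Unique (allVecs n xs)
  allVecs-unique zero    uniq = [] ∷ []
  allVecs-unique (suc n) uniq = Unique.cartesianProductWith⁺ _∷_ ∷-injective uniq (allVecs-unique n uniq)

  ∈-allVecs : {n : ℕ} {xs : List X} (v : Vec X n) → (∀ i → lookup v i ∈ xs) → v ∈ allVecs n xs
  ∈-allVecs []      h = here refl
  ∈-allVecs (x ∷ v) h = ∈-cartesianProductWith⁺ _∷_ (h zero) (∈-allVecs v (h ∘ suc))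

  -- Puts coordinate j innermost, so that a linear equation with a non-zero coefficient at j can be
  -- solved with all other coordinates fixed.
  ∑-insertAt : (n : ℕ) (xs : List X) (j : Fin (suc n)) (f : Vec X (suc n) → ℕ) →
    ∑ (allVecs (suc n) xs) f ≡ ∑[ v ← allVecs n xs ] ∑[ x ← xs ] f (insertAt v j x)
  ∑-insertAt n       xs zero    f = trans (∑-allVecs-suc n xs f) (∑-swap xs (allVecs n xs) _)
  ∑-insertAt (suc n) xs (suc j) f = begin
    ∑ (allVecs (suc (suc n)) xs) f
      ≡⟨ ∑-allVecs-suc (suc n) xs f ⟩
    ∑[ y ← xs ] ∑[ w ← allVecs (suc n) xs ] f (y ∷ w)
      ≡⟨ ∑-cong xs (λ y → ∑-insertAt n xs j (λ w → f (y ∷ w))) ⟩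
    ∑[ y ← xs ] ∑[ v ← allVecs n xs ] ∑[ x ← xs ] f (y ∷ insertAt v j x)
      ≡⟨ ∑-allVecs-suc n xs (λ v → ∑[ x ← xs ] f (insertAt v (suc j) x)) ⟨
    ∑[ v ← allVecs (suc n) xs ] ∑[ x ← xs ] f (insertAt v (suc j) x) ∎
    where open ≡-Reasoning

  insertColumn : {m n : ℕ} → Fin (suc n) → Vec X m → Vec (Vec X n) m → Vec (Vec X (suc n)) m
  insertColumn j = zipWith (λ x row → insertAt row j x)

  -- For m = n the remaining matrix B is square, and its determinant is, up to sign, the cofactor at
  -- j of the whole matrix.
  ∑-insertColumn : (m n : ℕ) (xs : List X) (j : Fin (suc n)) (f : Vec (Vec X (suc n)) m → ℕ) →
    ∑ (allVecs m (allVecs (suc n) xs)) f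
      ≡ ∑[ B ← allVecs m (allVecs n xs) ] ∑[ c ← allVecs m xs ] f (insertColumn j c B)
  ∑-insertColumn zero    n xs j f = sym (+-identityʳ _)
  ∑-insertColumn (suc m) n xs j f = begin
    ∑ (allVecs (suc m) (allVecs (suc n) xs)) f
      ≡⟨ ∑-allVecs-suc m (allVecs (suc n) xs) f ⟩
    ∑[ r ← allVecs (suc n) xs ] ∑[ M ← allVecs m (allVecs (suc n) xs) ] f (r ∷ M)
      ≡⟨ ∑-insertAt n xs j _ ⟩
    ∑[ v ← vs ] ∑[ x ← xs ] ∑[ M ← allVecs m (allVecs (suc n) xs) ] f (insertAt v j x ∷ M)
      ≡⟨ ∑-cong vs (λ v → ∑-cong xs (λ x → ∑-insertColumn m n xs j _)) ⟩
    ∑[ v ← vs ] ∑[ x ← xs ] ∑[ B ← Bs ] ∑[ c ← cs ] f (insertAt v j x ∷ insertColumn j c B)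
      ≡⟨ ∑-cong vs (λ v → ∑-swap xs Bs _) ⟩
    ∑[ v ← vs ] ∑[ B ← Bs ] ∑[ x ← xs ] ∑[ c ← cs ] f (insertAt v j x ∷ insertColumn j c B)
      ≡⟨ ∑-cong vs (λ v → ∑-cong Bs (λ B → sym (∑-allVecs-suc m xs (λ c → f (insertColumn j c (v ∷ B)))))) ⟩
    ∑[ v ← vs ] ∑[ B ← Bs ] ∑[ c ← allVecs (suc m) xs ] f (insertColumn j c (v ∷ B))
      ≡⟨ ∑-allVecs-suc m vs (λ B → ∑[ c ← allVecs (suc m) xs ] f (insertColumn j c B)) ⟨
    ∑[ B ← allVecs (suc m) vs ] ∑[ c ← allVecs (suc m) xs ] f (insertColumn j c B) ∎
    where
    open ≡-Reasoning
    vs = allVecs n xs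
    Bs = allVecs m vs
    cs = allVecs m xs

  -- The expansion of (x - y)² in a form without subtraction; both variance computations rest on it.
  ∣x-y∣²+2xy : ∀ x y → ∣ x - y ∣ * ∣ x - y ∣ + 2 * (x * y) ≡ x * x + y * y
  ∣x-y∣²+2xy x y with ≤-total x y
  ... | inj₁ x≤y with m≤n⇒∃[o]m+o≡n x≤y
  ...   | k , refl rewrite ∣m-m+n∣≡n x k = identity x k
    where
    identity : ∀ x k → k * k + 2 * (x * (x + k)) ≡ x * x + (x + k) * (x + k)
    identity = solve-∀
  ∣x-y∣²+2xy x y | inj₂ y≤x with m≤n⇒∃[o]m+o≡n y≤x
  ...   | k , refl rewrite ∣-∣-comm (y + k) y | ∣m-m+n∣≡n y k = identity y k
    where
    identity : ∀ y k → k * k + 2 * ((y + k) * y) ≡ (y + k) * (y + k) + y * y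
    identity = solve-∀

  2xy≤x²+y² : ∀ x y → 2 * (x * y) ≤ x * x + y * y
  2xy≤x²+y² x y = ≤-trans (m≤n+m _ (∣ x - y ∣ * ∣ x - y ∣)) (≤-reflexive (∣x-y∣²+2xy x y))

  -- Induction on the list: the cross term between the head y and the sum of the rest is split by
  -- applying 2 y z ≤ y² + z² to each later entry z.
  ∑-cauchy : (xs : List X) (f : X → ℕ) → ∑ xs f * ∑ xs f ≤ length xs * (∑[ x ← xs ] (f x * f x))
  ∑-cauchy []       f = z≤n
  ∑-cauchy (x ∷ xs) f = begin
    (y + s) * (y + s)                ≡⟨ expand y s ⟩
    y * y + 2 * (y * s) + s * s      ≤⟨ +-mono-≤ (+-monoʳ-≤ (y * y) cross) (∑-cauchy xs f) ⟩
    y * y + (n * (y * y) + sq) + n * sq ≡⟨ collect (y * y) n sq ⟩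
    suc n * (y * y + sq)              ∎
    where
    open ≤-Reasoning
    y = f x
    s = ∑ xs f
    n = length xs
    sq = ∑[ z ← xs ] (f z * f z)
    expand : ∀ y s → (y + s) * (y + s) ≡ y * y + 2 * (y * s) + s * s
    expand = solve-∀
    collect : ∀ a n sq → a + (n * a + sq) + n * sq ≡ suc n * (a + sq)
    collect = solve-∀
    cross : 2 * (y * s) ≤ n * (y * y) + sq
    cross = begin
      2 * (y * s)                           ≡⟨ cong (2 *_) (∑-*ˡ xs y f) ⟨
      2 * (∑[ z ← xs ] (y * f z))           ≡⟨ ∑-*ˡ xs 2 (λ z → y * f z) ⟨
      ∑[ z ← xs ] (2 * (y * f z))           ≤⟨ ∑-mono xs (λ z → 2xy≤x²+y² y (f z)) ⟩
      ∑[ z ← xs ] (y * y + f z * f z)       ≡⟨ ∑-+ xs (λ _ → y * y) (λ z → f z * f z) ⟩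
      (∑[ _ ← xs ] (y * y)) + sq             ≡⟨ cong (_+ sq) (∑-const xs (y * y)) ⟩
      n * (y * y) + sq                       ∎

  ∣-∣-∑ : (xs : List X) (f : X → ℕ) (c : ℕ) → ∣ ∑ xs f - length xs * c ∣ ≤ ∑[ x ← xs ] ∣ f x - c ∣
  ∣-∣-∑ []       f c = z≤n
  ∣-∣-∑ (x ∷ xs) f c = begin
    ∣ f x + s - (c + n) ∣                       ≤⟨ ∣-∣-triangle (f x + s) (c + s) (c + n) ⟩
    ∣ f x + s - (c + s) ∣ + ∣ c + s - (c + n) ∣ ≡⟨ cong₂ _+_ (trans (cong₂ ∣_-_∣ (+-comm (f x) s) (+-comm c s)) (∣m+n-m+o∣≡∣n-o∣ s (f x) c)) (∣m+n-m+o∣≡∣n-o∣ c s n) ⟩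
    ∣ f x - c ∣ + ∣ s - n ∣                     ≤⟨ +-monoʳ-≤ ∣ f x - c ∣ (∣-∣-∑ xs f c) ⟩
    ∣ f x - c ∣ + (∑[ y ← xs ] ∣ f y - c ∣)     ∎
    where
    open ≤-Reasoning
    s = ∑ xs f
    n = length xs * c

  𝟙-× : {P Q : Set} (p : Dec P) (q : Dec Q) → 𝟙 p * 𝟙 q ≡ 𝟙 (p ×-dec q)
  𝟙-× (yes _) (yes _) = refl
  𝟙-× (yes _) (no _)  = refl
  𝟙-× (no _)  _       = refl

  vec-ext : {X : Set} {n : ℕ} {v w : Vec X n} → (∀ i → lookup v i ≡ lookup w i) → v ≡ w
  vec-ext {v = []}    {[]}    h = refl
  vec-ext {v = x ∷ v} {y ∷ w} h = cong₂ _∷_ (h zero) (vec-ext (h ∘ suc))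

  insertAt-replicate : {X : Set} {n : ℕ} (x : X) (j : Fin (suc n)) → insertAt (Vec.replicate n x) j x ≡ Vec.replicate (suc n) x
  insertAt-replicate         x zero    = refl
  insertAt-replicate {n = suc n} x (suc j) = cong (x ∷_) (insertAt-replicate x j)

  -- The n coordinates other than j are free, and each choice of them leaves at most one entry at j.
  ∑𝟙-determined : {X : Set} {xs : List X} → Unique xs → (n : ℕ) (j : Fin (suc n))
    {R : Pred (Vec X (suc n)) _} (R? : Decidable R) →
    (∀ b {x y} → R (insertAt b j x) → R (insertAt b j y) → x ≡ y) →
    ∑[ c ← allVecs (suc n) xs ] 𝟙 (R? c) ≤ length xs ^ n
  ∑𝟙-determined {xs = xs} uniq n j R? det = begin
    ∑[ c ← allVecs (suc n) xs ] 𝟙 (R? c)                          ≡⟨ ∑-insertAt n xs j (λ c → 𝟙 (R? c)) ⟩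
    ∑[ b ← allVecs n xs ] ∑[ x ← xs ] 𝟙 (R? (insertAt b j x))     ≤⟨ ∑-≤-length (allVecs n xs) (λ {b} _ → ∑𝟙≤1 (λ x → R? (insertAt b j x)) uniq (λ _ _ → det b)) ⟩
    length (allVecs n xs) * 1                                     ≡⟨ *-identityʳ _ ⟩
    length (allVecs n xs)                                         ≡⟨ length-allVecs n xs ⟩
    length xs ^ n                                                 ∎
    where open ≤-Reasoning

  ∈-allVecs⁻ : {X : Set} (n : ℕ) {xs : List X} {v : Vec X n} → v ∈ allVecs n xs → ∀ i → lookup v i ∈ xs
  ∈-allVecs⁻ (suc n) {xs} v∈ i with ∈-cartesianProductWith⁻ _∷_ xs (allVecs n xs) v∈
  ∈-allVecs⁻ (suc n) v∈ zero    | x , w , x∈ , w∈ , refl = x∈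
  ∈-allVecs⁻ (suc n) v∈ (suc i) | x , w , x∈ , w∈ , refl = ∈-allVecs⁻ n w∈ i

  ∑-Pointwise : {X Y : Set} {R : X → Y → Set} {xs : List X} {ys : List Y} {f : X → ℕ} {g : Y → ℕ} →
    Pointwise R xs ys → (∀ {x y} → R x y → f x ≡ g y) → ∑ xs f ≡ ∑ ys g
  ∑-Pointwise []       h = refl
  ∑-Pointwise (r ∷ rs) h = cong₂ _+_ (h r) (∑-Pointwise rs h)

  module _ {X Y : Set} (R : X → Y → Set) where

    Represents : {n : ℕ} → (Fin n → X) → Vec Y n → Set
    Represents f v = ∀ i → R (f i) (lookup v i)

    -- Both enumerations run in the same order, so sums over them can be compared term by term,
    -- without function extensionality.
    allFuns-allVecs : (n : ℕ) {xs : List X} {ys : List Y} → Pointwise R xs ys → Pointwise Represents (allFuns n xs) (allVecs n ys)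
    allFuns-allVecs zero    rs = (λ ()) ∷ []
    allFuns-allVecs (suc n) {xs} {ys} rs = consing (allFuns-allVecs n rs) rs (λ x y f v r₀ r → λ { zero → r₀ ; (suc i) → r i })
      where
      -- `h` abstracts the pattern-matching lambda inside `allFuns`: a second copy of that lambda
      -- would not be definitionally equal to it.
      consing : {h : X → (Fin n → X) → Fin (suc n) → X} {fs : List (Fin n → X)} {vs : List (Vec Y n)} →
        Pointwise Represents fs vs → ∀ {xs ys} → Pointwise R xs ys →
        (∀ x y f v → R x y → Represents f v → Represents (h x f) (y ∷ v)) →
        Pointwise Represents (concatMap (λ x → map (h x) fs) xs) (cartesianProductWith _∷_ ys vs)
      consing reps []       h-rep = []
      consing reps (r ∷ rs) h-rep = Pointwise.++⁺
        (Pointwise.map⁺ _ _ (Pointwise.map (λ {f} {v} rep → h-rep _ _ f v r rep) reps))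
        (consing reps rs h-rep)

  ∑-allFin-suc : (n : ℕ) (f : Fin (suc n) → ℕ) → ∑ (allFin (suc n)) f ≡ f zero + ∑ (allFin n) (f ∘ suc)
  ∑-allFin-suc n f = cong (f zero +_)
    (trans (cong (λ xs → ∑ xs f) (sym (map-tabulate {n = n} id suc))) (∑-map suc (allFin n) f))

  ∑-subset : {n : ℕ} (A : Subset n) → ∑[ x ← allFin n ] 𝟙 (x ∈? A) ≡ ∣ A ∣
  ∑-subset []      = refl
  ∑-subset {suc n} (s ∷ A) = trans (∑-allFin-suc n (λ x → 𝟙 (x ∈? (s ∷ A))))
    (trans (cong (𝟙 (zero ∈? (s ∷ A)) +_)
      (trans (∑-cong (allFin n) λ x → 𝟙-cong (suc x ∈? (s ∷ A)) (x ∈? A) drop-there there) (∑-subset A))) (head s))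
    where
    head : ∀ s → 𝟙 (zero ∈? (s ∷ A)) + ∣ A ∣ ≡ ∣ s ∷ A ∣
    head true  = refl
    head false = refl

-- Field arithmetic, the alternating property of the determinant, and cofactor vectors

module LinearAlgebra {q : ℕ} (F : FiniteField q) where
  open import Data.Nat using (z≤n; s≤s; s≤s⁻¹)
  open FiniteField F renaming (_+_ to infixl 6 _⊕_; _*_ to infixl 7 _⊗_; -_ to infix 8 ⊖_; 0# to 0F; 1# to 1F) public

  K : Set
  K = Fin q

  commutativeRing : CommutativeRing 0ℓ 0ℓ
  commutativeRing = record { isCommutativeRing = isCommutativeRing }

  open CommutativeRing commutativeRing public
    using (+-assoc; +-comm; +-identityˡ; +-identityʳ; -‿inverseˡ; -‿inverseʳ; *-assoc; *-comm
          ; *-identityˡ; *-identityʳ; zeroˡ; zeroʳ; distribˡ; distribʳ)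
  open RingProperties (CommutativeRing.ring commutativeRing) public
    using (-‿distribˡ-*; -‿distribʳ-*; -‿involutive; -0#≈0#; -‿+-comm; +-cancelʳ)
  open ≡-Reasoning

  ⊕-interchange : ∀ a b c d → (a ⊕ b) ⊕ (c ⊕ d) ≡ (a ⊕ c) ⊕ (b ⊕ d)
  ⊕-interchange a b c d = begin
    (a ⊕ b) ⊕ (c ⊕ d) ≡⟨ +-assoc a b (c ⊕ d) ⟩
    a ⊕ (b ⊕ (c ⊕ d)) ≡⟨ cong (a ⊕_) (trans (sym (+-assoc b c d)) (trans (cong (_⊕ d) (+-comm b c)) (+-assoc c b d))) ⟩
    a ⊕ (c ⊕ (b ⊕ d)) ≡⟨ +-assoc a c (b ⊕ d) ⟨
    (a ⊕ c) ⊕ (b ⊕ d) ∎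

  ⊗-swapˡ : ∀ a b c → a ⊗ (b ⊗ c) ≡ b ⊗ (a ⊗ c)
  ⊗-swapˡ a b c = trans (sym (*-assoc a b c)) (trans (cong (_⊗ c) (*-comm a b)) (*-assoc b a c))

  -- Made total by the default value 0 at 0, so that `scale (inv l)` can appear under a sum without
  -- a proof that l is non-zero.
  inv : K → K
  inv x with x ≟ᶠ 0F
  ... | yes _  = 0F
  ... | no x≢0 = proj₁ (inverse x x≢0)

  inv-inverseʳ : ∀ {x} → ¬ (x ≡ 0F) → x ⊗ inv x ≡ 1F
  inv-inverseʳ {x} x≢0 with x ≟ᶠ 0F
  ... | yes x≡0 = ⊥-elim (x≢0 x≡0)
  ... | no x≢0′ = proj₂ (inverse x x≢0′)

  inv-inverseˡ : ∀ {x} → ¬ (x ≡ 0F) → inv x ⊗ x ≡ 1F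
  inv-inverseˡ {x} x≢0 = trans (*-comm (inv x) x) (inv-inverseʳ x≢0)

  inv-cancelˡ : ∀ {x} → ¬ (x ≡ 0F) → ∀ y → inv x ⊗ (x ⊗ y) ≡ y
  inv-cancelˡ {x} x≢0 y =
    trans (sym (*-assoc (inv x) x y)) (trans (cong (_⊗ y) (inv-inverseˡ x≢0)) (*-identityˡ y))

  inv-cancelʳ : ∀ {x} → ¬ (x ≡ 0F) → ∀ y → x ⊗ (inv x ⊗ y) ≡ y
  inv-cancelʳ {x} x≢0 y =
    trans (sym (*-assoc x (inv x) y)) (trans (cong (_⊗ y) (inv-inverseʳ x≢0)) (*-identityˡ y))

  ⊗-cancelˡ : ∀ {x y z} → ¬ (x ≡ 0F) → x ⊗ y ≡ x ⊗ z → y ≡ z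
  ⊗-cancelˡ {x} {y} {z} x≢0 eq =
    trans (sym (inv-cancelˡ x≢0 y)) (trans (cong (inv x ⊗_) eq) (inv-cancelˡ x≢0 z))

  ⊗-cancelʳ : ∀ {x y z} → ¬ (x ≡ 0F) → y ⊗ x ≡ z ⊗ x → y ≡ z
  ⊗-cancelʳ {x} {y} {z} x≢0 eq = ⊗-cancelˡ x≢0 (trans (*-comm x y) (trans eq (*-comm z x)))

  ∑± : (n : ℕ) → (Fin n → K) → K
  ∑± = altSum F

  ∑±-cong : (n : ℕ) {f g : Fin n → K} → (∀ i → f i ≡ g i) → ∑± n f ≡ ∑± n g
  ∑±-cong zero    h = refl
  ∑±-cong (suc n) h = cong₂ (λ a b → a ⊕ ⊖ b) (h zero) (∑±-cong n (h ∘ suc))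

  ∑±-zero : (n : ℕ) {f : Fin n → K} → (∀ i → f i ≡ 0F) → ∑± n f ≡ 0F
  ∑±-zero zero    h = refl
  ∑±-zero (suc n) h = trans (cong₂ (λ a b → a ⊕ ⊖ b) (h zero) (∑±-zero n (h ∘ suc)))
                            (-‿inverseʳ 0F)

  ⊖-⊕ : ∀ a b → ⊖ (a ⊕ b) ≡ ⊖ a ⊕ ⊖ b
  ⊖-⊕ a b = sym (-‿+-comm a b)

  ∑±-⊗ˡ : (n : ℕ) (c : K) (f : Fin n → K) → c ⊗ ∑± n f ≡ ∑± n (λ i → c ⊗ f i)
  ∑±-⊗ˡ zero    c f = zeroʳ c
  ∑±-⊗ˡ (suc n) c f = begin
    c ⊗ (f zero ⊕ ⊖ ∑± n (f ∘ suc))     ≡⟨ distribˡ c _ _ ⟩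
    c ⊗ f zero ⊕ c ⊗ ⊖ ∑± n (f ∘ suc)   ≡⟨ cong (c ⊗ f zero ⊕_) (sym (-‿distribʳ-* c _)) ⟩
    c ⊗ f zero ⊕ ⊖ (c ⊗ ∑± n (f ∘ suc)) ≡⟨ cong (λ z → c ⊗ f zero ⊕ ⊖ z) (∑±-⊗ˡ n c (f ∘ suc)) ⟩
    c ⊗ f zero ⊕ ⊖ ∑± n (λ i → c ⊗ f (suc i)) ∎

  ∑±-⊖⊕ : (n : ℕ) (f g : Fin n → K) → ∑± n (λ i → f i ⊕ ⊖ g i) ≡ ∑± n f ⊕ ⊖ ∑± n g
  ∑±-⊖⊕ zero    f g = sym (-‿inverseʳ 0F)
  ∑±-⊖⊕ (suc n) f g = begin
    (f zero ⊕ ⊖ g zero) ⊕ ⊖ ∑± n (λ i → f (suc i) ⊕ ⊖ g (suc i))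
      ≡⟨ cong (λ z → (f zero ⊕ ⊖ g zero) ⊕ ⊖ z) (∑±-⊖⊕ n (f ∘ suc) (g ∘ suc)) ⟩
    (f zero ⊕ ⊖ g zero) ⊕ ⊖ (s ⊕ ⊖ t)
      ≡⟨ cong ((f zero ⊕ ⊖ g zero) ⊕_) (⊖-⊕ s (⊖ t)) ⟩
    (f zero ⊕ ⊖ g zero) ⊕ (⊖ s ⊕ ⊖ ⊖ t)
      ≡⟨ ⊕-interchange _ _ _ _ ⟩
    (f zero ⊕ ⊖ s) ⊕ (⊖ g zero ⊕ ⊖ ⊖ t)
      ≡⟨ cong ((f zero ⊕ ⊖ s) ⊕_) (⊖-⊕ (g zero) (⊖ t)) ⟨
    (f zero ⊕ ⊖ s) ⊕ ⊖ (g zero ⊕ ⊖ t) ∎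
    where
    s = ∑± n (f ∘ suc)
    t = ∑± n (g ∘ suc)

  -- The shape of an expansion along the top two rows: k indexes the columns left after column j is
  -- deleted, and the sign is (-1)^(j+k).
  ∑±∑± : (n : ℕ) → (Fin (suc n) → Fin n → K) → K
  ∑±∑± n G = ∑± (suc n) (λ j → ∑± n (G j))

  -- Separates the terms with j = 0 and those with k = 0. In the remaining terms both indices drop
  -- by one, so the signs are unchanged and induction applies.
  ∑±∑±-peel : (n : ℕ) (G : Fin (suc (suc n)) → Fin (suc n) → K) →
    ∑±∑± (suc n) G ≡ ∑± (suc n) (G zero) ⊕ (⊖ ∑± (suc n) (λ j → G (suc j) zero) ⊕ ∑±∑± n (λ j k → G (suc j) (suc k)))
  ∑±∑±-peel n G = cong (∑± (suc n) (G zero) ⊕_) (begin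
    ⊖ ∑± (suc n) (λ j → G (suc j) zero ⊕ ⊖ ∑± n (λ k → G (suc j) (suc k)))
      ≡⟨ cong ⊖_ (∑±-⊖⊕ (suc n) (λ j → G (suc j) zero) (λ j → ∑± n (λ k → G (suc j) (suc k)))) ⟩
    ⊖ (∑± (suc n) (λ j → G (suc j) zero) ⊕ ⊖ ∑±∑± n (λ j k → G (suc j) (suc k)))
      ≡⟨ ⊖-⊕ _ _ ⟩
    ⊖ ∑± (suc n) (λ j → G (suc j) zero) ⊕ ⊖ ⊖ ∑±∑± n (λ j k → G (suc j) (suc k))
      ≡⟨ cong (⊖ ∑± (suc n) (λ j → G (suc j) zero) ⊕_) (-‿involutive _) ⟩
    ⊖ ∑± (suc n) (λ j → G (suc j) zero) ⊕ ∑±∑± n (λ j k → G (suc j) (suc k)) ∎)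

  -- H is G with the two deleted columns taken in the opposite order: (j , k) names the
  -- ordered pair of distinct columns j and punch j k.
  Flipped : {n : ℕ} → (G H : Fin (suc n) → Fin n → K) → Set
  Flipped {n} G H = ∀ (j k : Fin n) → j Fin.≤ k → G (inject₁ j) k ≡ H (suc k) j

  -- The equal terms at (j , k) and (k + 1 , j), for j ≤ k, carry opposite signs. Peeling cancels
  -- the pairs that involve column 0, and the rest is again flipped to itself; no division by 2
  -- occurs.
  ∑±∑±-flip-self : (n : ℕ) (G : Fin (suc n) → Fin n → K) → Flipped G G → ∑±∑± n G ≡ 0F
  ∑±∑±-flip-self zero    G sym-G = -‿inverseʳ 0F
  ∑±∑±-flip-self (suc n) G sym-G = begin
    ∑±∑± (suc n) G            ≡⟨ ∑±∑±-peel n G ⟩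
    a ⊕ (⊖ b ⊕ r)             ≡⟨ cong₂ (λ x y → x ⊕ (⊖ b ⊕ y)) (∑±-cong (suc n) (λ k → sym-G zero k z≤n))
                                   (∑±∑±-flip-self n (λ j k → G (suc j) (suc k)) (λ j k j≤k → sym-G (suc j) (suc k) (s≤s j≤k))) ⟩
    b ⊕ (⊖ b ⊕ 0F)            ≡⟨ cong (b ⊕_) (+-identityʳ (⊖ b)) ⟩
    b ⊕ ⊖ b                   ≡⟨ -‿inverseʳ b ⟩
    0F                        ∎
    where
    a = ∑± (suc n) (G zero)
    b = ∑± (suc n) (λ j → G (suc j) zero)
    r = ∑±∑± n (λ j k → G (suc j) (suc k))

  -- The same pairing across two arrays: the terms of G with j = 0 cancel those of H with k = 0, and
  -- conversely.
  ∑±∑±-flip : (n : ℕ) (G H : Fin (suc n) → Fin n → K) → Flipped G H → Flipped H G → ∑±∑± n G ⊕ ∑±∑± n H ≡ 0F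
  ∑±∑±-flip zero    G H GH HG = trans (cong₂ _⊕_ (-‿inverseʳ 0F) (-‿inverseʳ 0F)) (+-identityˡ 0F)
  ∑±∑±-flip (suc n) G H GH HG = begin
    ∑±∑± (suc n) G ⊕ ∑±∑± (suc n) H
      ≡⟨ cong₂ _⊕_ (∑±∑±-peel n G) (∑±∑±-peel n H) ⟩
    (a ⊕ (⊖ b ⊕ r)) ⊕ (a′ ⊕ (⊖ b′ ⊕ r′))
      ≡⟨ cong₂ (λ x y → (a ⊕ (⊖ x ⊕ r)) ⊕ (a′ ⊕ (⊖ y ⊕ r′)))
           (sym (∑±-cong (suc n) (λ k → HG zero k z≤n))) (sym (∑±-cong (suc n) (λ k → GH zero k z≤n))) ⟩
    (a ⊕ (⊖ a′ ⊕ r)) ⊕ (a′ ⊕ (⊖ a ⊕ r′))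
      ≡⟨ cong₂ _⊕_ (sym (+-assoc a (⊖ a′) r)) (sym (+-assoc a′ (⊖ a) r′)) ⟩
    ((a ⊕ ⊖ a′) ⊕ r) ⊕ ((a′ ⊕ ⊖ a) ⊕ r′)
      ≡⟨ ⊕-interchange _ r _ r′ ⟩
    ((a ⊕ ⊖ a′) ⊕ (a′ ⊕ ⊖ a)) ⊕ (r ⊕ r′)
      ≡⟨ cong₂ _⊕_ cancel (∑±∑±-flip n (λ j k → G (suc j) (suc k)) (λ j k → H (suc j) (suc k)) (λ j k j≤k → GH (suc j) (suc k) (s≤s j≤k))
                                            (λ j k j≤k → HG (suc j) (suc k) (s≤s j≤k))) ⟩
    0F ⊕ 0F ≡⟨ +-identityˡ 0F ⟩
    0F ∎
    where
    a  = ∑± (suc n) (G zero)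
    b  = ∑± (suc n) (λ j → G (suc j) zero)
    r  = ∑±∑± n (λ j k → G (suc j) (suc k))
    a′ = ∑± (suc n) (H zero)
    b′ = ∑± (suc n) (λ j → H (suc j) zero)
    r′ = ∑±∑± n (λ j k → H (suc j) (suc k))
    cancel : (a ⊕ ⊖ a′) ⊕ (a′ ⊕ ⊖ a) ≡ 0F
    cancel = begin
      (a ⊕ ⊖ a′) ⊕ (a′ ⊕ ⊖ a) ≡⟨ cong ((a ⊕ ⊖ a′) ⊕_) (+-comm a′ (⊖ a)) ⟩
      (a ⊕ ⊖ a′) ⊕ (⊖ a ⊕ a′) ≡⟨ ⊕-interchange a _ _ a′ ⟩
      (a ⊕ ⊖ a) ⊕ (⊖ a′ ⊕ a′) ≡⟨ cong₂ _⊕_ (-‿inverseʳ a) (-‿inverseˡ a′) ⟩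
      0F ⊕ 0F                 ≡⟨ +-identityˡ 0F ⟩
      0F ∎

  det-cong : (n : ℕ) {M M′ : Fin n → Fin n → K} → (∀ r c → M r c ≡ M′ r c) → det F n M ≡ det F n M′
  det-cong zero    h = refl
  det-cong (suc n) h = ∑±-cong (suc n) λ j → cong₂ _⊗_ (h zero j) (det-cong n λ r c → h (suc r) (punch F j c))

  -- The simplicial identity for coface maps: the columns left after two deletions do not depend on
  -- the order of the deletions.
  punch-punch : {n : ℕ} (j k : Fin (suc n)) → j Fin.≤ k → (c : Fin n) →
    punch F (inject₁ j) (punch F k c) ≡ punch F (suc k) (punch F j c)
  punch-punch zero    k       _   c       = refl
  punch-punch (suc j) (suc k) j≤k zero    = refl
  punch-punch (suc j) (suc k) j≤k (suc c) = cong suc (punch-punch j k (s≤s⁻¹ j≤k) c)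

  punch-suc-≤ : {n : ℕ} (j k : Fin n) → j Fin.≤ k → punch F (suc k) j ≡ inject₁ j
  punch-suc-≤ zero    k       _   = refl
  punch-suc-≤ (suc j) (suc k) j≤k = cong suc (punch-suc-≤ j k (s≤s⁻¹ j≤k))

  punch-inject₁-≤ : {n : ℕ} (j k : Fin n) → j Fin.≤ k → punch F (inject₁ j) k ≡ suc k
  punch-inject₁-≤ zero    k       _   = refl
  punch-inject₁-≤ (suc j) (suc k) j≤k = cong suc (punch-inject₁-≤ j k (s≤s⁻¹ j≤k))

  module _ {n : ℕ} (M : Fin n → Fin (suc (suc n)) → K) where

    twoRowTerm : (x y : Fin (suc (suc n)) → K) → Fin (suc (suc n)) → Fin (suc n) → K
    twoRowTerm x y j k = x j ⊗ (y (punch F j k) ⊗ det F n (λ r c → M r (punch F j (punch F k c))))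

    det-two-rows : (x y : Fin (suc (suc n)) → K) →
      det F (suc (suc n)) (x ◂ (y ◂ M)) ≡ ∑±∑± (suc n) (twoRowTerm x y)
    det-two-rows x y = ∑±-cong (suc (suc n)) λ j → ∑±-⊗ˡ (suc n) (x j)
      (λ k → y (punch F j k) ⊗ det F n (λ r c → M r (punch F j (punch F k c))))

    twoRowTerm-flipped : (x y : Fin (suc (suc n)) → K) → Flipped (twoRowTerm x y) (twoRowTerm y x)
    twoRowTerm-flipped x y j k j≤k
      rewrite punch-inject₁-≤ j k j≤k | punch-suc-≤ j k j≤k
            | det-cong n (λ r c → cong (M r) (punch-punch j k j≤k c)) =
      ⊗-swapˡ (x (inject₁ j)) (y (suc k)) _

    det-equal-rows₀₁ : (x : Fin (suc (suc n)) → K) → det F (suc (suc n)) (x ◂ (x ◂ M)) ≡ 0F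
    det-equal-rows₀₁ x = trans (det-two-rows x x) (∑±∑±-flip-self (suc n) (twoRowTerm x x) (twoRowTerm-flipped x x))

    det-swap-rows₀₁ : (x y : Fin (suc (suc n)) → K) →
      det F (suc (suc n)) (x ◂ (y ◂ M)) ⊕ det F (suc (suc n)) (y ◂ (x ◂ M)) ≡ 0F
    det-swap-rows₀₁ x y = trans (cong₂ _⊕_ (det-two-rows x y) (det-two-rows y x))
      (∑±∑±-flip (suc n) (twoRowTerm x y) (twoRowTerm y x) (twoRowTerm-flipped x y) (twoRowTerm-flipped y x))

  -- If the copy of x is not directly below it, swap the top two rows. Expanding the swapped
  -- determinant along its new top row leaves minors with x on top and its copy one place nearer,
  -- which vanish by induction; the swap only changes the sign.
  det-repeated-row : (n : ℕ) (x : Fin (suc n) → K) (M : Fin n → Fin (suc n) → K) (r : Fin n) →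
    (∀ c → M r c ≡ x c) → det F (suc n) (x ◂ M) ≡ 0F
  det-repeated-row (suc n) x M zero    h = trans
    (det-cong (suc (suc n)) {x ◂ M} {x ◂ (x ◂ (M ∘ suc))} λ where
      zero          c → refl
      (suc zero)    c → h c
      (suc (suc r)) c → refl)
    (det-equal-rows₀₁ (M ∘ suc) x)
  det-repeated-row (suc n) x M (suc r) h = begin
    det F (suc (suc n)) (x ◂ M)
      ≡⟨ +-identityʳ _ ⟨
    det F (suc (suc n)) (x ◂ M) ⊕ 0F
      ≡⟨ cong (det F (suc (suc n)) (x ◂ M) ⊕_) swapped ⟨
    det F (suc (suc n)) (x ◂ M) ⊕ det F (suc (suc n)) (M zero ◂ (x ◂ (M ∘ suc)))
      ≡⟨ det-swap-rows₀₁ (M ∘ suc) x (M zero) ⟩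
    0F ∎
    where
    swapped : det F (suc (suc n)) (M zero ◂ (x ◂ (M ∘ suc))) ≡ 0F
    swapped = ∑±-zero (suc (suc n)) λ j → trans
      (cong (M zero j ⊗_) (det-repeated-row n (x ∘ punch F j) (λ s c → M (suc s) (punch F j c)) r (λ c → h (punch F j c))))
      (zeroʳ (M zero j))

  -- Dot products, linear combinations of rows, and the cofactor vector

  dot : {n : ℕ} → Vec K n → Vec K n → K
  dot []       []       = 0F
  dot (x ∷ xs) (y ∷ ys) = x ⊗ y ⊕ dot xs ys

  dot-insertAt : {n : ℕ} (b : Vec K n) (j : Fin (suc n)) (x : K) (v : Vec K (suc n)) →
    dot (insertAt b j x) v ≡ x ⊗ lookup v j ⊕ dot b (removeAt v j)
  dot-insertAt b       zero    x (y ∷ v) = refl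
  dot-insertAt (z ∷ b) (suc j) x (y ∷ v@(_ ∷ _)) = begin
    z ⊗ y ⊕ dot (insertAt b j x) v                     ≡⟨ cong (z ⊗ y ⊕_) (dot-insertAt b j x v) ⟩
    z ⊗ y ⊕ (x ⊗ lookup v j ⊕ dot b (removeAt v j))    ≡⟨ +-assoc _ _ _ ⟨
    (z ⊗ y ⊕ x ⊗ lookup v j) ⊕ dot b (removeAt v j)    ≡⟨ cong (_⊕ dot b (removeAt v j)) (+-comm _ _) ⟩
    (x ⊗ lookup v j ⊕ z ⊗ y) ⊕ dot b (removeAt v j)    ≡⟨ +-assoc _ _ _ ⟩
    x ⊗ lookup v j ⊕ (z ⊗ y ⊕ dot b (removeAt v j))    ∎

  scale : {n : ℕ} → K → Vec K n → Vec K n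
  scale c = Vec.map (c ⊗_)

  _⊞_ : {n : ℕ} → Vec K n → Vec K n → Vec K n
  _⊞_ = zipWith _⊕_

  𝟎 : {n : ℕ} → Vec K n
  𝟎 = Vec.replicate _ 0F

  dot-scaleˡ : {n : ℕ} (c : K) (v w : Vec K n) → dot (scale c v) w ≡ c ⊗ dot v w
  dot-scaleˡ c []      []      = sym (zeroʳ c)
  dot-scaleˡ c (x ∷ v) (y ∷ w) =
    trans (cong₂ _⊕_ (*-assoc c x y) (dot-scaleˡ c v w)) (sym (distribˡ c (x ⊗ y) (dot v w)))

  dot-scaleʳ : {n : ℕ} (c : K) (v w : Vec K n) → dot v (scale c w) ≡ c ⊗ dot v w
  dot-scaleʳ c []      []      = sym (zeroʳ c)
  dot-scaleʳ c (x ∷ v) (y ∷ w) =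
    trans (cong₂ _⊕_ (⊗-swapˡ x c y) (dot-scaleʳ c v w)) (sym (distribˡ c (x ⊗ y) (dot v w)))

  dot-⊞ˡ : {n : ℕ} (u v w : Vec K n) → dot (u ⊞ v) w ≡ dot u w ⊕ dot v w
  dot-⊞ˡ []      []      []      = sym (+-identityˡ 0F)
  dot-⊞ˡ (x ∷ u) (y ∷ v) (z ∷ w) =
    trans (cong₂ _⊕_ (distribʳ z x y) (dot-⊞ˡ u v w)) (⊕-interchange _ _ _ _)

  dot-⊞ʳ : {n : ℕ} (u v w : Vec K n) → dot u (v ⊞ w) ≡ dot u v ⊕ dot u w
  dot-⊞ʳ []      []      []      = sym (+-identityˡ 0F)
  dot-⊞ʳ (x ∷ u) (y ∷ v) (z ∷ w) =
    trans (cong₂ _⊕_ (distribˡ x y z) (dot-⊞ʳ u v w)) (⊕-interchange _ _ _ _)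

  dot-𝟎ˡ : {n : ℕ} (v : Vec K n) → dot 𝟎 v ≡ 0F
  dot-𝟎ˡ []      = refl
  dot-𝟎ˡ (x ∷ v) = trans (cong₂ _⊕_ (zeroˡ x) (dot-𝟎ˡ v)) (+-identityˡ 0F)

  dot-𝟎ʳ : {n : ℕ} (v : Vec K n) → dot v 𝟎 ≡ 0F
  dot-𝟎ʳ []      = refl
  dot-𝟎ʳ (x ∷ v) = trans (cong₂ _⊕_ (zeroʳ x) (dot-𝟎ʳ v)) (+-identityˡ 0F)

  combine : {m n : ℕ} → Vec K m → Vec (Vec K n) m → Vec K n
  combine []      []      = 𝟎
  combine (x ∷ z) (r ∷ B) = scale x r ⊞ combine z B

  dot-combine : {m n : ℕ} (z : Vec K m) (B : Vec (Vec K n) m) (y : Vec K n) →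
    dot (combine z B) y ≡ dot z (Vec.map (λ row → dot row y) B)
  dot-combine []      []      y = dot-𝟎ˡ y
  dot-combine (x ∷ z) (r ∷ B) y =
    trans (dot-⊞ˡ (scale x r) (combine z B) y) (cong₂ _⊕_ (dot-scaleˡ x r y) (dot-combine z B y))

  sign : {n : ℕ} → Fin n → K
  sign zero    = 1F
  sign (suc j) = ⊖ sign j

  sign-⊗-sign : {n : ℕ} (j : Fin n) → sign j ⊗ sign j ≡ 1F
  sign-⊗-sign zero    = *-identityˡ 1F
  sign-⊗-sign (suc j) = begin
    ⊖ sign j ⊗ ⊖ sign j    ≡⟨ -‿distribˡ-* (sign j) (⊖ sign j) ⟨
    ⊖ (sign j ⊗ ⊖ sign j)  ≡⟨ cong ⊖_ (-‿distribʳ-* (sign j) (sign j)) ⟨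
    ⊖ ⊖ (sign j ⊗ sign j)  ≡⟨ -‿involutive _ ⟩
    sign j ⊗ sign j        ≡⟨ sign-⊗-sign j ⟩
    1F                     ∎

  dot-⊖ : {n : ℕ} (v : Vec K n) (f g : Fin n → K) → (∀ j → f j ≡ ⊖ g j) → dot v (tabulate f) ≡ ⊖ dot v (tabulate g)
  dot-⊖ []      f g h = sym -0#≈0#
  dot-⊖ (x ∷ v) f g h = begin
    x ⊗ f zero ⊕ dot v (tabulate (f ∘ suc))      ≡⟨ cong₂ _⊕_ (cong (x ⊗_) (h zero)) (dot-⊖ v (f ∘ suc) (g ∘ suc) (h ∘ suc)) ⟩
    x ⊗ ⊖ g zero ⊕ ⊖ dot v (tabulate (g ∘ suc))  ≡⟨ cong (_⊕ ⊖ dot v (tabulate (g ∘ suc))) (-‿distribʳ-* x (g zero)) ⟨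
    ⊖ (x ⊗ g zero) ⊕ ⊖ dot v (tabulate (g ∘ suc)) ≡⟨ ⊖-⊕ _ _ ⟨
    ⊖ (x ⊗ g zero ⊕ dot v (tabulate (g ∘ suc)))  ∎

  ∑±-dot : {n : ℕ} (v : Vec K n) (f : Fin n → K) →
    ∑± n (λ j → lookup v j ⊗ f j) ≡ dot v (tabulate (λ j → sign j ⊗ f j))
  ∑±-dot []      f = refl
  ∑±-dot (x ∷ v) f = cong₂ _⊕_ (cong (x ⊗_) (sym (*-identityˡ (f zero)))) (begin
    ⊖ ∑± _ (λ j → lookup v j ⊗ f (suc j))             ≡⟨ cong ⊖_ (∑±-dot v (f ∘ suc)) ⟩
    ⊖ dot v (tabulate (λ j → sign j ⊗ f (suc j)))     ≡⟨ dot-⊖ v _ _ (λ j → sym (-‿distribˡ-* (sign j) (f (suc j)))) ⟨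
    dot v (tabulate (λ j → ⊖ sign j ⊗ f (suc j)))     ∎)

  entries : {A : Set} {m n : ℕ} → Vec (Vec A n) m → Fin m → Fin n → A
  entries M r c = lookup (lookup M r) c

  -- The generalised cross product of n vectors in dimension n + 1.
  cofactors : {n : ℕ} → Vec (Vec K (suc n)) n → Vec K (suc n)
  cofactors {n} M = tabulate λ j → sign j ⊗ det F n (λ r c → entries M r (punch F j c))

  det-∷ : {n : ℕ} (a : Vec K (suc n)) (M : Vec (Vec K (suc n)) n) →
    det F (suc n) (entries (a ∷ M)) ≡ dot a (cofactors M)
  det-∷ {n} a M = ∑±-dot a (λ j → det F n (λ r c → entries M r (punch F j c)))

  -- The dot product is the determinant of M with a copy of its row r placed on top.
  dot-row-cofactors : {n : ℕ} (M : Vec (Vec K (suc n)) n) (r : Fin n) → dot (lookup M r) (cofactors M) ≡ 0F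
  dot-row-cofactors {n} M r = trans (sym (det-∷ (lookup M r) M))
    (trans (det-cong (suc n) {entries (lookup M r ∷ M)} {lookup (lookup M r) ◂ entries M} λ where
              zero    c → refl
              (suc s) c → refl)
           (det-repeated-row n (lookup (lookup M r)) (entries M) r (λ c → refl)))

-- Points on hyperplanes, linear dependence, and collisions of cofactor vectors

module Counting {q : ℕ} (F : FiniteField q) where
  open import Data.Nat using (_+_; _≤_; _<_; z≤n; s≤s; ∣_-_∣)
  open Sums
  open LinearAlgebra F

  infix 4 _≟ᵥ_
  _≟ᵥ_ : {n : ℕ} (v w : Vec K n) → Dec (v ≡ w)
  _≟ᵥ_ = ≡-dec _≟ᶠ_

  vecs : (n : ℕ) → List (Vec K n)
  vecs n = allVecs n (allFin q)

  vecs-unique : (n : ℕ) → Unique (vecs n)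
  vecs-unique n = allVecs-unique n (Unique.allFin⁺ q)

  ∈-vecs : {n : ℕ} (v : Vec K n) → v ∈ vecs n
  ∈-vecs v = ∈-allVecs v (λ i → ∈-allFin (lookup v i))

  length-allFin : length (allFin q) ≡ q
  length-allFin = length-tabulate id

  length-vecs : (n : ℕ) → length (vecs n) ≡ q ^ n
  length-vecs n = trans (length-allVecs n (allFin q)) (cong (_^ n) length-allFin)

  nonzero-coordinate : {n : ℕ} {v : Vec K n} → ¬ (v ≡ 𝟎) → ∃ λ j → ¬ (lookup v j ≡ 0F)
  nonzero-coordinate {v = []}    v≢𝟎 = ⊥-elim (v≢𝟎 refl)
  nonzero-coordinate {v = x ∷ v} v≢𝟎 with x ≟ᶠ 0F
  ... | no x≢0   = zero , x≢0
  ... | yes refl with nonzero-coordinate {v = v} (v≢𝟎 ∘ cong (0F ∷_))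
  ...   | j , vj≢0 = suc j , vj≢0

  distinct-coordinate : {n : ℕ} {v w : Vec K n} → ¬ (v ≡ w) → ∃ λ j → ¬ (lookup v j ≡ lookup w j)
  distinct-coordinate {v = []}    {[]}    v≢w = ⊥-elim (v≢w refl)
  distinct-coordinate {v = x ∷ v} {y ∷ w} v≢w with x ≟ᶠ y
  ... | no x≢y   = zero , x≢y
  ... | yes refl with distinct-coordinate {v = v} {w} (v≢w ∘ cong (x ∷_))
  ...   | j , vj≢wj = suc j , vj≢wj

  dot-insertAt-injective : {n : ℕ} (b : Vec K n) (j : Fin (suc n)) (v : Vec K (suc n)) {x y : K} →
    ¬ (lookup v j ≡ 0F) → dot (insertAt b j x) v ≡ dot (insertAt b j y) v → x ≡ y
  dot-insertAt-injective b j v {x} {y} vj≢0 eq = ⊗-cancelʳ vj≢0 (+-cancelʳ (dot b (removeAt v j)) _ _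
    (trans (sym (dot-insertAt b j x v)) (trans eq (dot-insertAt b j y v))))

  hyperplane-≤ : {xs : List K} → Unique xs → (n : ℕ) (v : Vec K (suc n)) (s : K) → ¬ (v ≡ 𝟎) →
    ∑[ b ← allVecs (suc n) xs ] 𝟙 (dot b v ≟ᶠ s) ≤ length xs ^ n
  hyperplane-≤ uniq n v s v≢𝟎 with nonzero-coordinate v≢𝟎
  ... | j , vj≢0 = ∑𝟙-determined uniq n j (λ b → dot b v ≟ᶠ s)
    (λ b p p′ → dot-insertAt-injective b j v vj≢0 (trans p (sym p′)))

  dot-solution : {n : ℕ} (b : Vec K n) (j : Fin (suc n)) (v : Vec K (suc n)) (s : K) →
    ¬ (lookup v j ≡ 0F) → ∃ λ x → dot (insertAt b j x) v ≡ s
  dot-solution b j v s vj≢0 = x , (begin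
    dot (insertAt b j x) v   ≡⟨ dot-insertAt b j x v ⟩
    x ⊗ lookup v j ⊕ t       ≡⟨ cong (_⊕ t) (trans (*-comm x _) (inv-cancelʳ vj≢0 _)) ⟩
    (s ⊕ ⊖ t) ⊕ t            ≡⟨ +-assoc s (⊖ t) t ⟩
    s ⊕ (⊖ t ⊕ t)            ≡⟨ cong (s ⊕_) (-‿inverseˡ t) ⟩
    s ⊕ 0F                   ≡⟨ +-identityʳ s ⟩
    s                        ∎)
    where
    open ≡-Reasoning
    t = dot b (removeAt v j)
    x = inv (lookup v j) ⊗ (s ⊕ ⊖ t)

  hyperplane-≡ : (n : ℕ) (v : Vec K (suc n)) (s : K) → ¬ (v ≡ 𝟎) →
    ∑[ b ← vecs (suc n) ] 𝟙 (dot b v ≟ᶠ s) ≡ q ^ n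
  hyperplane-≡ n v s v≢𝟎 with nonzero-coordinate v≢𝟎
  ... | j , vj≢0 = begin
    ∑[ b ← vecs (suc n) ] 𝟙 (dot b v ≟ᶠ s)
      ≡⟨ ∑-insertAt n (allFin q) j (λ b → 𝟙 (dot b v ≟ᶠ s)) ⟩
    ∑[ b ← vecs n ] ∑[ x ← allFin q ] 𝟙 (dot (insertAt b j x) v ≟ᶠ s)
      ≡⟨ ∑-cong (vecs n) (λ b → ∑𝟙≡1 (λ x → dot (insertAt b j x) v ≟ᶠ s) (Unique.allFin⁺ q)
           (λ _ _ p p′ → dot-insertAt-injective b j v vj≢0 (trans p (sym p′)))
           (∈-allFin _) (proj₂ (dot-solution b j v s vj≢0))) ⟩
    ∑[ _ ← vecs n ] 1
      ≡⟨ length≡∑1 (vecs n) ⟨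
    length (vecs n)
      ≡⟨ length-vecs n ⟩
    q ^ n ∎
    where open ≡-Reasoning

  -- Eliminating a pivot coordinate of v from v′ leaves w; when w = 0 the vectors are
  -- proportional, and the two equations are then compatible only if v = v′.
  two-hyperplanes-≤ : (n : ℕ) (v v′ : Vec K (suc (suc n))) → ¬ (v ≡ 𝟎) → ¬ (v ≡ v′) →
    ∑[ b ← vecs (suc (suc n)) ] (𝟙 (dot b v ≟ᶠ 1F) * 𝟙 (dot b v′ ≟ᶠ 1F)) ≤ q ^ n
  two-hyperplanes-≤ n v v′ v≢𝟎 v≢v′ with nonzero-coordinate v≢𝟎
  ... | j , vj≢0 = begin
    ∑[ b ← vecs (suc (suc n)) ] (𝟙 (dot b v ≟ᶠ 1F) * 𝟙 (dot b v′ ≟ᶠ 1F))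
      ≡⟨ ∑-cong (vecs (suc (suc n))) (λ b → 𝟙-× (dot b v ≟ᶠ 1F) (dot b v′ ≟ᶠ 1F)) ⟩
    ∑[ b ← vecs (suc (suc n)) ] 𝟙 (on b)
      ≡⟨ ∑-insertAt (suc n) (allFin q) j (λ b → 𝟙 (on b)) ⟩
    ∑[ b ← vecs (suc n) ] ∑[ x ← allFin q ] 𝟙 (on (insertAt b j x))
      ≤⟨ ∑-mono (vecs (suc n)) (λ b → ≤-𝟙-* (dot b w′ ≟ᶠ 1F ⊕ c)
           (λ h → let (x , _ , p , p′) = ∑𝟙-witness (λ x → on (insertAt b j x)) (allFin q) h in on-w′ b x p p′)
           (λ _ → ∑𝟙≤1 (λ x → on (insertAt b j x)) (Unique.allFin⁺ q)
                    (λ _ _ p p′ → dot-insertAt-injective b j v vj≢0 (trans (proj₁ p) (sym (proj₁ p′)))))) ⟩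
    ∑[ b ← vecs (suc n) ] (𝟙 (dot b w′ ≟ᶠ 1F ⊕ c) * 1)
      ≡⟨ ∑-cong (vecs (suc n)) (λ b → ℕ.*-identityʳ _) ⟩
    ∑[ b ← vecs (suc n) ] 𝟙 (dot b w′ ≟ᶠ 1F ⊕ c)
      ≤⟨ reduced ⟩
    q ^ n ∎
    where
    open ℕ.≤-Reasoning
    on : ∀ b → Dec (dot b v ≡ 1F × dot b v′ ≡ 1F)
    on b = (dot b v ≟ᶠ 1F) ×-dec (dot b v′ ≟ᶠ 1F)
    c = ⊖ (lookup v′ j ⊗ inv (lookup v j))
    w = v′ ⊞ scale c v
    w′ = removeAt w j
    lookup-w : ∀ i → lookup w i ≡ lookup v′ i ⊕ c ⊗ lookup v i
    lookup-w i = trans (lookup-zipWith _⊕_ i v′ (scale c v)) (cong (lookup v′ i ⊕_) (lookup-map i (c ⊗_) v))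
    w-j : lookup w j ≡ 0F
    w-j = trans (lookup-w j) (trans (cong (lookup v′ j ⊕_) (trans (sym (-‿distribˡ-* _ _))
      (cong ⊖_ (trans (*-assoc _ _ _) (trans (cong (lookup v′ j ⊗_) (inv-inverseˡ vj≢0)) (*-identityʳ _))))))
      (-‿inverseʳ (lookup v′ j)))
    on-w′ : ∀ b x → dot (insertAt b j x) v ≡ 1F → dot (insertAt b j x) v′ ≡ 1F → dot b w′ ≡ 1F ⊕ c
    on-w′ b x p p′ = trans (sym (trans (dot-insertAt b j x w)
        (trans (cong (λ z → x ⊗ z ⊕ dot b w′) w-j) (trans (cong (_⊕ dot b w′) (zeroʳ x)) (+-identityˡ _)))))
      (trans (dot-⊞ʳ (insertAt b j x) v′ (scale c v))
        (cong₂ _⊕_ p′ (trans (dot-scaleʳ c (insertAt b j x) v) (trans (cong (c ⊗_) p) (*-identityʳ c)))))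
    proportional : w ≡ 𝟎 → ¬ (1F ⊕ c ≡ 0F)
    proportional w≡𝟎 1+c≡0 = v≢v′ (vec-ext λ i → sym (+-cancelʳ (c ⊗ lookup v i) _ _
      (trans (sym (lookup-w i)) (trans (cong (λ z → lookup z i) w≡𝟎) (trans (lookup-replicate i 0F)
        (sym (trans (cong (_⊕ c ⊗ lookup v i) (sym (*-identityˡ _)))
          (trans (sym (distribʳ (lookup v i) 1F c)) (trans (cong (_⊗ lookup v i) 1+c≡0) (zeroˡ _))))))))))
    w′≡𝟎⇒w≡𝟎 : w′ ≡ 𝟎 → w ≡ 𝟎
    w′≡𝟎⇒w≡𝟎 eq = trans (sym (insertAt-removeAt w j)) (trans (cong₂ (λ u x → insertAt u j x) eq w-j) (insertAt-replicate 0F j))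
    reduced : ∑[ b ← vecs (suc n) ] 𝟙 (dot b w′ ≟ᶠ 1F ⊕ c) ≤ q ^ n
    reduced with w′ ≟ᵥ 𝟎
    ... | no w′≢𝟎 = ℕ.≤-reflexive (hyperplane-≡ n w′ (1F ⊕ c) w′≢𝟎)
    ... | yes w′≡𝟎 = ℕ.≤-trans (ℕ.≤-reflexive (∑-zero (vecs (suc n)) λ {b} _ → 𝟙-no (dot b w′ ≟ᶠ 1F ⊕ c) λ eq →
        proportional (w′≡𝟎⇒w≡𝟎 w′≡𝟎) (trans (sym eq) (trans (cong (dot b) w′≡𝟎) (dot-𝟎ʳ b))))) z≤n

  1<q : 1 < q
  1<q = two-elements 0F 1F 0≢1
    where
    two-elements : {n : ℕ} (x y : Fin n) → ¬ (x ≡ y) → 1 < n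
    two-elements {suc zero}    zero zero x≢y = ⊥-elim (x≢y refl)
    two-elements {suc (suc n)} _    _    _   = s≤s (s≤s z≤n)

  -- Pigeonhole in place of elimination: q^(m+1) coefficient vectors have only q^m possible
  -- combinations. Finiteness makes the search for a collision decidable.
  collision : {m : ℕ} (B : Vec (Vec K m) (suc m)) → ∃ λ z → ∃ λ z′ → ¬ (z ≡ z′) × combine z B ≡ combine z′ B
  collision {m} B with any? (λ z → any? (λ z′ → ¬? (z ≟ᵥ z′) ×-dec (combine z B ≟ᵥ combine z′ B)) (vecs (suc m))) (vecs (suc m))
  ... | yes found with Any.satisfied found
  ...   | z , found′ with Any.satisfied found′
  ...     | z′ , p = z , z′ , p
  collision {m} B | no none = ⊥-elim (ℕ.<-irrefl refl (ℕ.<-≤-trans (ℕ.^-monoʳ-< q 1<q (ℕ.n<1+n m)) q^1+m≤q^m))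
    where
    injective : ∀ {z z′} → combine z B ≡ combine z′ B → z ≡ z′
    injective {z} {z′} eq = decidable-stable (z ≟ᵥ z′) λ z≢z′ →
      none (Any.map (λ { refl → Any.map (λ { refl → z≢z′ , eq }) (∈-vecs z′) }) (∈-vecs z))
    open ℕ.≤-Reasoning
    q^1+m≤q^m : q ^ suc m ≤ q ^ m
    q^1+m≤q^m = begin
      q ^ suc m                                                              ≡⟨ length-vecs (suc m) ⟨
      length (vecs (suc m))                                                  ≡⟨ length≡∑1 (vecs (suc m)) ⟩
      -- Each z is counted through the single y equal to `combine z B`; under injectivity no y is
      -- used twice.
      ∑[ z ← vecs (suc m) ] 1                                                ≡⟨ ∑-cong (vecs (suc m)) (λ z → sym (∑-δ _≟ᵥ_ (vecs-unique m) (∈-vecs (combine z B)) (λ _ → 1))) ⟩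
      ∑[ z ← vecs (suc m) ] ∑[ y ← vecs m ] (𝟙 (combine z B ≟ᵥ y) * 1)       ≡⟨ ∑-swap (vecs (suc m)) (vecs m) _ ⟩
      ∑[ y ← vecs m ] ∑[ z ← vecs (suc m) ] (𝟙 (combine z B ≟ᵥ y) * 1)       ≡⟨ ∑-cong (vecs m) (λ y → ∑-cong (vecs (suc m)) λ z → ℕ.*-identityʳ _) ⟩
      ∑[ y ← vecs m ] ∑[ z ← vecs (suc m) ] 𝟙 (combine z B ≟ᵥ y)             ≤⟨ ∑-≤-length (vecs m) (λ {y} _ → ∑𝟙≤1 (λ z → combine z B ≟ᵥ y) (vecs-unique (suc m)) λ _ _ p p′ → injective (trans p (sym p′))) ⟩
      length (vecs m) * 1                                                    ≡⟨ trans (ℕ.*-identityʳ _) (length-vecs m) ⟩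
      q ^ m                                                                  ∎

  dot-comm : {n : ℕ} (v w : Vec K n) → dot v w ≡ dot w v
  dot-comm []      []      = refl
  dot-comm (x ∷ v) (y ∷ w) = cong₂ _⊕_ (*-comm x y) (dot-comm v w)

  -- The difference of two coefficient vectors with the same combination of rows. It serves as the
  -- normal of a hyperplane that contains all columns of B, since B has more rows than columns.
  left-kernel : {m : ℕ} (B : Vec (Vec K m) (suc m)) →
    ∃ λ w → ¬ (w ≡ 𝟎) × (∀ y → dot (Vec.map (λ row → dot row y) B) w ≡ 0F)
  left-kernel B with collision B
  ... | z , z′ , z≢z′ , eq with distinct-coordinate z≢z′
  ... | r , zr≢z′r = w , w≢𝟎 , orthogonal
    where
    open ≡-Reasoning
    w = z ⊞ scale (⊖ 1F) z′
    ⊖1⊗ : ∀ x → ⊖ 1F ⊗ x ≡ ⊖ x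
    ⊖1⊗ x = trans (sym (-‿distribˡ-* 1F x)) (cong ⊖_ (*-identityˡ x))
    w≢𝟎 : ¬ (w ≡ 𝟎)
    w≢𝟎 w≡𝟎 = zr≢z′r (+-cancelʳ (⊖ lookup z′ r) _ _ (begin
      lookup z r ⊕ ⊖ lookup z′ r            ≡⟨ cong (lookup z r ⊕_) (trans (lookup-map r (⊖ 1F ⊗_) z′) (⊖1⊗ _)) ⟨
      lookup z r ⊕ lookup (scale (⊖ 1F) z′) r ≡⟨ lookup-zipWith _⊕_ r z (scale (⊖ 1F) z′) ⟨
      lookup w r                            ≡⟨ cong (λ u → lookup u r) w≡𝟎 ⟩
      lookup 𝟎 r                            ≡⟨ lookup-replicate r 0F ⟩
      0F                                    ≡⟨ -‿inverseʳ _ ⟨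
      lookup z′ r ⊕ ⊖ lookup z′ r           ∎))
    orthogonal : ∀ y → dot (Vec.map (λ row → dot row y) B) w ≡ 0F
    orthogonal y = begin
      dot By w                                       ≡⟨ dot-comm By w ⟩
      dot w By                                       ≡⟨ dot-⊞ˡ z (scale (⊖ 1F) z′) By ⟩
      dot z By ⊕ dot (scale (⊖ 1F) z′) By            ≡⟨ cong (dot z By ⊕_) (trans (dot-scaleˡ (⊖ 1F) z′ By) (⊖1⊗ _)) ⟩
      dot z By ⊕ ⊖ dot z′ By                         ≡⟨ cong₂ (λ a b → a ⊕ ⊖ b) (sym (dot-combine z B y)) (sym (dot-combine z′ B y)) ⟩
      dot (combine z B) y ⊕ ⊖ dot (combine z′ B) y   ≡⟨ cong (λ u → dot u y ⊕ ⊖ dot (combine z′ B) y) eq ⟩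
      dot (combine z′ B) y ⊕ ⊖ dot (combine z′ B) y  ≡⟨ -‿inverseʳ _ ⟩
      0F                                             ∎
      where By = Vec.map (λ row → dot row y) B

  minor-insertColumn : {n : ℕ} (j : Fin (suc n)) (c : Vec K n) (B : Vec (Vec K n) n) →
    lookup (cofactors (insertColumn j c B)) j ≡ sign j ⊗ det F n (entries B)
  minor-insertColumn {n} j c B = trans (lookup∘tabulate (λ i → sign i ⊗ det F n (λ r k → entries (insertColumn j c B) r (punch F i k))) j)
    (cong (sign j ⊗_) (det-cong n λ r k →
    trans (cong (λ row → lookup row (punch F j k)) (lookup-zipWith (λ x row → insertAt row j x) r c B))
          (lookup-insertAt-punch (lookup B r) j (lookup c r) k)))
    where
    lookup-insertAt-punch : {n : ℕ} (v : Vec K n) (j : Fin (suc n)) (x : K) (k : Fin n) →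
      lookup (insertAt v j x) (punch F j k) ≡ lookup v k
    lookup-insertAt-punch v       zero    x k       = refl
    lookup-insertAt-punch (y ∷ v) (suc j) x zero    = refl
    lookup-insertAt-punch (y ∷ v) (suc j) x (suc k) = lookup-insertAt-punch v j x k

  sign-⊗-cancel : {n : ℕ} (j : Fin n) {x y : K} → sign j ⊗ x ≡ sign j ⊗ y → x ≡ y
  sign-⊗-cancel j {x} {y} eq = trans (sym (simplify x)) (trans (cong (sign j ⊗_) eq) (simplify y))
    where
    simplify : ∀ x → sign j ⊗ (sign j ⊗ x) ≡ x
    simplify x = trans (sym (*-assoc _ _ _)) (trans (cong (_⊗ x) (sign-⊗-sign j)) (*-identityˡ x))

  -- Orthogonality of row r to the cofactor vector, with the entry from the inserted column split
  -- off; it can be solved for that entry when v is non-zero at j.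
  row-equation : {n : ℕ} (j : Fin (suc n)) (c : Vec K n) (B : Vec (Vec K n) n) (r : Fin n) →
    let v = cofactors (insertColumn j c B) in
    lookup c r ⊗ lookup v j ⊕ dot (lookup B r) (removeAt v j) ≡ 0F
  row-equation j c B r = trans (sym (dot-insertAt (lookup B r) j (lookup c r) v))
    (trans (cong (λ row → dot row v) (sym (lookup-zipWith (λ x row → insertAt row j x) r c B)))
           (dot-row-cofactors (insertColumn j c B) r))
    where v = cofactors (insertColumn j c B)

  -- Both columns satisfy the same row equations, in which the unknown entries have the non-zero
  -- coefficient at j.
  column-determined : {n : ℕ} (j : Fin (suc n)) (B : Vec (Vec K n) n) (c c′ : Vec K n) →
    cofactors (insertColumn j c B) ≡ cofactors (insertColumn j c′ B) →
    ¬ (lookup (cofactors (insertColumn j c B)) j ≡ 0F) → c ≡ c′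
  column-determined j B c c′ eq vj≢0 = vec-ext λ r → ⊗-cancelʳ vj≢0 (+-cancelʳ _ _ _
    (trans (row-equation j c B r) (sym (subst (λ v → lookup c′ r ⊗ lookup v j ⊕ dot (lookup B r) (removeAt v j) ≡ 0F)
      (sym eq) (row-equation j c′ B r)))))

  -- Pairs of matrices with a common non-zero cofactor vector

  module _ (xs : List K) (n : ℕ) where

    squareMatrices : List (Vec (Vec K n) n)
    squareMatrices = allVecs n (allVecs n xs)

    wideMatrices : List (Vec (Vec K (suc n)) n)
    wideMatrices = allVecs n (allVecs (suc n) xs)

    detCount : K → ℕ
    detCount t = ∑[ B ← squareMatrices ] 𝟙 (det F n (entries B) ≟ᶠ t)

    detEnergy : ℕ
    detEnergy = ∑[ t ← units F ] (detCount t * detCount t)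

    sameDet? : (B B′ : Vec (Vec K n) n) → Dec (det F n (entries B) ≡ det F n (entries B′) × ¬ (det F n (entries B) ≡ 0F))
    sameDet? B B′ = (det F n (entries B) ≟ᶠ det F n (entries B′)) ×-dec ¬? (det F n (entries B) ≟ᶠ 0F)

    ∑-sameDet≤detEnergy : ∑[ B ← squareMatrices ] ∑[ B′ ← squareMatrices ] 𝟙 (sameDet? B B′) ≤ detEnergy
    ∑-sameDet≤detEnergy = begin
      ∑[ B ← Bs ] ∑[ B′ ← Bs ] 𝟙 (sameDet? B B′)
        ≤⟨ ∑-mono Bs (λ B → ∑-mono Bs λ B′ → 𝟙-elim (sameDet? B B′) (pick B B′)) ⟩
      ∑[ B ← Bs ] ∑[ B′ ← Bs ] ∑[ t ← units F ] (is B t * is B′ t)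
        ≡⟨ ∑-cong Bs (λ B → ∑-swap Bs (units F) _) ⟩
      ∑[ B ← Bs ] ∑[ t ← units F ] ∑[ B′ ← Bs ] (is B t * is B′ t)
        ≡⟨ ∑-swap Bs (units F) _ ⟩
      ∑[ t ← units F ] ∑[ B ← Bs ] ∑[ B′ ← Bs ] (is B t * is B′ t)
        ≡⟨ ∑-cong (units F) (λ t → ∑-product Bs Bs (λ B → is B t) (λ B → is B t)) ⟩
      detEnergy ∎
      where
      open ℕ.≤-Reasoning
      Bs = squareMatrices
      is : Vec (Vec K n) n → K → ℕ
      is B t = 𝟙 (det F n (entries B) ≟ᶠ t)
      pick : ∀ B B′ → det F n (entries B) ≡ det F n (entries B′) × ¬ (det F n (entries B) ≡ 0F) →
        1 ≤ ∑[ t ← units F ] (is B t * is B′ t)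
      pick B B′ (eq , t≢0) = ℕ.≤-trans
        (ℕ.≤-reflexive (sym (cong₂ _*_ (𝟙-yes (det F n (entries B) ≟ᶠ det F n (entries B)) refl) (𝟙-yes (det F n (entries B′) ≟ᶠ det F n (entries B)) (sym eq)))))
        (term≤∑ (units F) (λ t → is B t * is B′ t) (∈-filter⁺ (λ x → ¬? (x ≟ᶠ 0F)) (∈-allFin _) t≢0))

    -- Remove column j from both matrices, leaving (c , B) and (c′ , B′). Equal cofactors at j force
    -- B and B′ to have the same non-zero determinant, and c′ is determined by B′ and the common
    -- cofactor vector. So only the pair (B , B′) and c are free, and κ bounds the choices of c.
    pivot-bound : Unique xs → (j : Fin (suc n)) {R : Pred (Vec (Vec K (suc n)) n) _} (R? : Decidable R) (κ : ℕ) →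
      (∀ {M} → R M → ¬ (lookup (cofactors M) j ≡ 0F)) →
      (∀ B → ∑[ c ← allVecs n xs ] 𝟙 (R? (insertColumn j c B)) ≤ κ) →
      ∑[ M ← wideMatrices ] ∑[ M′ ← wideMatrices ] 𝟙 ((cofactors M ≟ᵥ cofactors M′) ×-dec R? M) ≤ detEnergy * κ
    pivot-bound uniq j {R} R? κ pivot bound = begin
      ∑[ M ← wideMatrices ] ∑[ M′ ← wideMatrices ] 𝟙 (both M M′)
        ≡⟨ ∑-insertColumn n n xs j (λ M → ∑[ M′ ← wideMatrices ] 𝟙 (both M M′)) ⟩
      ∑[ B ← Bs ] ∑[ c ← cs ] ∑[ M′ ← wideMatrices ] 𝟙 (both (insertColumn j c B) M′)
        ≡⟨ ∑-cong Bs (λ B → ∑-cong cs λ c → ∑-insertColumn n n xs j (λ M′ → 𝟙 (both (insertColumn j c B) M′))) ⟩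
      ∑[ B ← Bs ] ∑[ c ← cs ] ∑[ B′ ← Bs ] ∑[ c′ ← cs ] 𝟙 (both (insertColumn j c B) (insertColumn j c′ B′))
        ≤⟨ ∑-mono Bs (λ B → ∑-mono cs λ c → ∑-mono Bs λ B′ → unique-column B c B′) ⟩
      ∑[ B ← Bs ] ∑[ c ← cs ] ∑[ B′ ← Bs ] (𝟙 (sameDet? B B′) * 𝟙 (R? (insertColumn j c B)))
        ≡⟨ ∑-cong Bs (λ B → trans (∑-swap cs Bs _) (∑-cong Bs λ B′ → ∑-*ˡ cs (𝟙 (sameDet? B B′)) _)) ⟩
      ∑[ B ← Bs ] ∑[ B′ ← Bs ] (𝟙 (sameDet? B B′) * (∑[ c ← cs ] 𝟙 (R? (insertColumn j c B))))
        ≤⟨ ∑-mono Bs (λ B → ∑-mono Bs λ B′ → ℕ.*-monoʳ-≤ (𝟙 (sameDet? B B′)) (bound B)) ⟩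
      ∑[ B ← Bs ] ∑[ B′ ← Bs ] (𝟙 (sameDet? B B′) * κ)
        ≡⟨ trans (∑-cong Bs (λ B → ∑-*ʳ Bs (λ B′ → 𝟙 (sameDet? B B′)) κ)) (∑-*ʳ Bs (λ B → ∑[ B′ ← Bs ] 𝟙 (sameDet? B B′)) κ) ⟩
      (∑[ B ← Bs ] ∑[ B′ ← Bs ] 𝟙 (sameDet? B B′)) * κ
        ≤⟨ ℕ.*-monoˡ-≤ κ ∑-sameDet≤detEnergy ⟩
      detEnergy * κ ∎
      where
      open ℕ.≤-Reasoning
      Bs = squareMatrices
      cs = allVecs n xs
      both : ∀ M M′ → Dec (cofactors M ≡ cofactors M′ × R M)
      both M M′ = (cofactors M ≟ᵥ cofactors M′) ×-dec R? M
      equal-dets : ∀ B c B′ c′ → cofactors (insertColumn j c B) ≡ cofactors (insertColumn j c′ B′) → R (insertColumn j c B) →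
        det F n (entries B) ≡ det F n (entries B′) × ¬ (det F n (entries B) ≡ 0F)
      equal-dets B c B′ c′ eq rM =
        sign-⊗-cancel j (trans (sym (minor-insertColumn j c B)) (trans (cong (λ v → lookup v j) eq) (minor-insertColumn j c′ B′))) ,
        λ d≡0 → pivot rM (trans (minor-insertColumn j c B) (trans (cong (sign j ⊗_) d≡0) (zeroʳ (sign j))))
      unique-column : ∀ B c B′ → ∑[ c′ ← cs ] 𝟙 (both (insertColumn j c B) (insertColumn j c′ B′))
        ≤ 𝟙 (sameDet? B B′) * 𝟙 (R? (insertColumn j c B))
      unique-column B c B′ = begin
        ∑[ c′ ← cs ] 𝟙 (both (insertColumn j c B) (insertColumn j c′ B′))
          ≤⟨ ≤-𝟙-* (sameDet? B B′ ×-dec R? (insertColumn j c B))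
               (λ h → let (c′ , _ , eq , rM) = ∑𝟙-witness (λ c′ → both (insertColumn j c B) (insertColumn j c′ B′)) cs h
                      in equal-dets B c B′ c′ eq rM , rM)
               (λ _ → ∑𝟙≤1 (λ c′ → both (insertColumn j c B) (insertColumn j c′ B′)) (allVecs-unique n uniq)
                        (λ { {c₁} {c₂} _ _ (eq₁ , rM) (eq₂ , _) → column-determined j B′ c₁ c₂ (trans (sym eq₁) eq₂)
                               (λ z → pivot rM (trans (cong (λ v → lookup v j) eq₁) z)) })) ⟩
        𝟙 (sameDet? B B′ ×-dec R? (insertColumn j c B)) * 1
          ≡⟨ trans (ℕ.*-identityʳ _) (sym (𝟙-× (sameDet? B B′) (R? (insertColumn j c B)))) ⟩
        𝟙 (sameDet? B B′) * 𝟙 (R? (insertColumn j c B)) ∎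

  dot-zero-head : {n : ℕ} (b v : Vec K (suc n)) → lookup v zero ≡ 0F → dot b v ≡ dot (tail b) (tail v)
  dot-zero-head (x ∷ b) (y ∷ v) y≡0 =
    trans (cong (λ z → x ⊗ z ⊕ dot b v) y≡0) (trans (cong (_⊕ dot b v) (zeroʳ x)) (+-identityˡ _))

  -- Solving the row equations for the inserted column writes it as a combination of the columns of
  -- B with the same coefficients in every row. As v₀ = 0, the first column of B drops out, which is
  -- why only the tails of the rows enter.
  column-in-span : {m : ℕ} (j : Fin (suc m)) (c : Vec K (suc m)) (B : Vec (Vec K (suc m)) (suc m)) →
    let v = cofactors (insertColumn (suc j) c B) in
    ¬ (lookup v (suc j) ≡ 0F) → lookup v zero ≡ 0F →
    ∃ λ y → c ≡ Vec.map (λ row → dot row y) (Vec.map tail B)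
  column-in-span {m} j c B vj≢0 v₀≡0 = y , vec-ext λ r → begin
    lookup c r                                        ≡⟨ solve-for (row-equation (suc j) c B r) ⟩
    k ⊗ dot (lookup B r) u                            ≡⟨ cong (k ⊗_) (dot-zero-head (lookup B r) u (trans (head-removeAt v j) v₀≡0)) ⟩
    k ⊗ dot (tail (lookup B r)) (tail u)              ≡⟨ dot-scaleʳ k (tail (lookup B r)) (tail u) ⟨
    dot (tail (lookup B r)) y                         ≡⟨ cong (λ row → dot row y) (lookup-map r tail B) ⟨
    dot (lookup (Vec.map tail B) r) y                 ≡⟨ lookup-map r (λ row → dot row y) (Vec.map tail B) ⟨
    lookup (Vec.map (λ row → dot row y) (Vec.map tail B)) r ∎
    where
    open ≡-Reasoning
    v = cofactors (insertColumn (suc j) c B)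
    u = removeAt v (suc j)
    k = ⊖ inv (lookup v (suc j))
    y = scale k (tail u)
    head-removeAt : {n : ℕ} (v : Vec K (suc (suc n))) (j : Fin (suc n)) → lookup (removeAt v (suc j)) zero ≡ lookup v zero
    head-removeAt (x ∷ _ ∷ _) j = refl
    solve-for : ∀ {x s} → x ⊗ lookup v (suc j) ⊕ s ≡ 0F → x ≡ k ⊗ s
    solve-for {x} {s} eq = ⊗-cancelʳ vj≢0 (+-cancelʳ s _ _ (trans eq (sym (begin
      k ⊗ s ⊗ lookup v (suc j) ⊕ s
        ≡⟨ cong (_⊕ s) (trans (*-comm _ _) (trans (cong (lookup v (suc j) ⊗_) (sym (-‿distribˡ-* _ s)))
             (trans (sym (-‿distribʳ-* _ _)) (cong ⊖_ (inv-cancelʳ vj≢0 s))))) ⟩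
      ⊖ s ⊕ s ≡⟨ -‿inverseˡ s ⟩
      0F ∎))))

  module _ (xs : List K) (m : ℕ) where

    private
      n : ℕ
      n = suc m
      cs : List (Vec K n)
      cs = allVecs n xs
      Ms : List (Vec (Vec K (suc n)) n)
      Ms = wideMatrices xs n

      S : ℕ
      S = detEnergy xs n

    TailPivot : Fin n → Pred (Vec (Vec K (suc n)) n) _
    TailPivot j M = ¬ (lookup (cofactors M) (suc j) ≡ 0F) × lookup (cofactors M) zero ≡ 0F

    tailPivot? : (j : Fin n) → Decidable (TailPivot j)
    tailPivot? j M = ¬? (lookup (cofactors M) (suc j) ≟ᶠ 0F) ×-dec (lookup (cofactors M) zero ≟ᶠ 0F)

    -- The tails of the rows of B form m + 1 rows of length m, so their left kernel vector w depends
    -- on B alone. Every admissible c is orthogonal to w, which leaves |A|^m columns instead of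
    -- |A|^(m+1).
    tail-pivot-columns : Unique xs → (j : Fin n) (B : Vec (Vec K n) n) →
      ∑[ c ← cs ] 𝟙 (tailPivot? j (insertColumn (suc j) c B)) ≤ length xs ^ m
    tail-pivot-columns uniq j B with left-kernel (Vec.map tail B)
    ... | w , w≢𝟎 , orthogonal = ℕ.≤-trans
      (∑-mono cs λ c → 𝟙-mono (tailPivot? j (insertColumn (suc j) c B)) (dot c w ≟ᶠ 0F) λ (vj≢0 , v₀≡0) →
        let (y , eq) = column-in-span j c B vj≢0 v₀≡0 in trans (cong (λ c → dot c w) eq) (orthogonal y))
      (hyperplane-≤ uniq m w 0F w≢𝟎)

    cofactorEnergy : ℕ
    cofactorEnergy = ∑[ M ← Ms ] ∑[ M′ ← Ms ] 𝟙 ((cofactors M ≟ᵥ cofactors M′) ×-dec ¬? (cofactors M ≟ᵥ 𝟎))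

    -- Pairs with v₀ = 0 may be counted once for each non-zero later coordinate; this union bound
    -- puts the factor n on the term of lower order only.
    cofactorEnergy-≤ : Unique xs → cofactorEnergy ≤ S * length xs ^ n + n * (S * length xs ^ m)
    cofactorEnergy-≤ uniq = begin
      cofactorEnergy
        ≤⟨ ∑-mono Ms (λ M → ∑-mono Ms λ M′ → split M M′) ⟩
      ∑[ M ← Ms ] ∑[ M′ ← Ms ] (first M M′ + (∑[ j ← allFin n ] later j M M′))
        ≡⟨ trans (∑-cong Ms λ M → ∑-+ Ms (first M) _) (∑-+ Ms _ _) ⟩
      (∑[ M ← Ms ] ∑[ M′ ← Ms ] first M M′) + (∑[ M ← Ms ] ∑[ M′ ← Ms ] ∑[ j ← allFin n ] later j M M′)
        ≡⟨ cong ((∑[ M ← Ms ] ∑[ M′ ← Ms ] first M M′) +_)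
             (trans (∑-cong Ms λ M → ∑-swap Ms (allFin n) _) (∑-swap Ms (allFin n) _)) ⟩
      (∑[ M ← Ms ] ∑[ M′ ← Ms ] first M M′) + (∑[ j ← allFin n ] ∑[ M ← Ms ] ∑[ M′ ← Ms ] later j M M′)
        ≤⟨ ℕ.+-mono-≤
             (pivot-bound xs n uniq zero (λ M → ¬? (lookup (cofactors M) zero ≟ᶠ 0F)) _ id
               (λ B → ℕ.≤-trans (∑-≤-length cs {c = 1} λ {c} _ → 𝟙≤1 (¬? (lookup (cofactors (insertColumn zero c B)) zero ≟ᶠ 0F)))
                        (ℕ.≤-reflexive (trans (ℕ.*-identityʳ _) (length-allVecs n xs)))))
             (∑-≤-length (allFin n) λ {j} _ → pivot-bound xs n uniq (suc j) (tailPivot? j) _ proj₁ (tail-pivot-columns uniq j)) ⟩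
      S * length xs ^ n + length (allFin n) * (S * length xs ^ m)
        ≡⟨ cong (λ k → S * length xs ^ n + k * (S * length xs ^ m)) (length-tabulate {n = n} id) ⟩
      S * length xs ^ n + n * (S * length xs ^ m) ∎
      where
      open ℕ.≤-Reasoning
      same : ∀ M M′ → Dec (cofactors M ≡ cofactors M′)
      same M M′ = cofactors M ≟ᵥ cofactors M′
      first : ∀ M M′ → ℕ
      first M M′ = 𝟙 (same M M′ ×-dec ¬? (lookup (cofactors M) zero ≟ᶠ 0F))
      later : Fin n → ∀ M M′ → ℕ
      later j M M′ = 𝟙 (same M M′ ×-dec tailPivot? j M)
      𝟙≤1 : {P : Set} (p : Dec P) → 𝟙 p ≤ 1
      𝟙≤1 p = 𝟙-elim p (λ _ → ℕ.≤-refl)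
      split : ∀ M M′ → 𝟙 (same M M′ ×-dec ¬? (cofactors M ≟ᵥ 𝟎)) ≤ first M M′ + (∑[ j ← allFin n ] later j M M′)
      split M M′ = 𝟙-elim (same M M′ ×-dec ¬? (cofactors M ≟ᵥ 𝟎)) λ (eq , nz) → go eq (lookup (cofactors M) zero ≟ᶠ 0F) (nonzero-coordinate nz)
        where
        go : cofactors M ≡ cofactors M′ → Dec (lookup (cofactors M) zero ≡ 0F) → (∃ λ j → ¬ (lookup (cofactors M) j ≡ 0F)) →
          1 ≤ first M M′ + (∑[ j ← allFin n ] later j M M′)
        go eq (no v₀≢0)  _ = ℕ.≤-trans
          (ℕ.≤-reflexive (sym (𝟙-yes (same M M′ ×-dec ¬? (lookup (cofactors M) zero ≟ᶠ 0F)) (eq , v₀≢0)))) (ℕ.m≤m+n _ _)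
        go eq (yes v₀≡0) (zero  , v₀≢0) = ⊥-elim (v₀≢0 v₀≡0)
        go eq (yes v₀≡0) (suc j , vj≢0) = ℕ.≤-trans
          (ℕ.≤-reflexive (sym (𝟙-yes (same M M′ ×-dec tailPivot? j M) (eq , vj≢0 , v₀≡0))))
          (ℕ.≤-trans (term≤∑ (allFin n) (λ j → later j M M′) (∈-allFin j)) (ℕ.m≤n+m _ (first M M′)))

-- Variance of incidences b · v = 1 and the resulting second-moment inequality

module Sieve {q : ℕ} (F : FiniteField q) where
  open import Data.Nat using (_+_; _≤_; _<_; z≤n; s≤s; ∣_-_∣)
  open Sums
  open LinearAlgebra F
  open Counting F

  nonzero? : (x : K) → Dec (¬ (x ≡ 0F))
  nonzero? x = ¬? (x ≟ᶠ 0F)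

  unit≢0 : ∀ {l} → l ∈ units F → ¬ (l ≡ 0F)
  unit≢0 l∈ = proj₂ (∈-filter⁻ nonzero? {xs = allFin q} l∈)

  units-unique : Unique (units F)
  units-unique = Unique.filter⁺ nonzero? (Unique.allFin⁺ q)

  q≤1+#units : q ≤ 1 + length (units F)
  q≤1+#units = begin
    q                                                                   ≡⟨ length-allFin ⟨
    length (allFin q)                                                   ≡⟨ length≡∑1 (allFin q) ⟩
    ∑[ _ ← allFin q ] 1                                                 ≤⟨ ∑-mono (allFin q) cases ⟩
    ∑[ x ← allFin q ] (𝟙 (x ≟ᶠ 0F) + 𝟙 (nonzero? x))                    ≡⟨ ∑-+ (allFin q) _ _ ⟩
    (∑[ x ← allFin q ] 𝟙 (x ≟ᶠ 0F)) + (∑[ x ← allFin q ] 𝟙 (nonzero? x)) ≤⟨ ℕ.+-mono-≤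
      (∑𝟙≤1 (_≟ᶠ 0F) (Unique.allFin⁺ q) (λ _ _ p p′ → trans p (sym p′)))
      (ℕ.≤-reflexive (sym (length-filter-∑ nonzero? (allFin q)))) ⟩
    1 + length (units F)                                                ∎
    where
    open ℕ.≤-Reasoning
    cases : ∀ x → 1 ≤ 𝟙 (x ≟ᶠ 0F) + 𝟙 (nonzero? x)
    cases x with x ≟ᶠ 0F
    ... | yes _ = s≤s z≤n
    ... | no _  = s≤s z≤n

  module _ (n : ℕ) (Vs : List (Vec K (suc (suc n)))) where

    private
      d : ℕ
      d = suc (suc n)
      T : ℕ
      T = length Vs

    multiplicity : Vec K d → ℕ
    multiplicity b = ∑[ v ← Vs ] 𝟙 (dot b v ≟ᶠ 1F)

    energy : ℕ
    energy = ∑[ v ← Vs ] ∑[ v′ ← Vs ] 𝟙 (v ≟ᵥ v′)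

    -- The mean of `multiplicity` over all b is T / q when no v is zero; the factor q keeps the
    -- deviation from it in ℕ.
    deviation : Vec K d → ℕ
    deviation b = ∣ q * multiplicity b - T ∣

    module Moments (Vs≢𝟎 : ∀ {v} → v ∈ Vs → ¬ (v ≡ 𝟎)) where

      first-moment : ∑ (vecs d) multiplicity ≡ T * q ^ suc n
      first-moment = begin
        ∑[ b ← vecs d ] ∑[ v ← Vs ] 𝟙 (dot b v ≟ᶠ 1F)  ≡⟨ ∑-swap (vecs d) Vs _ ⟩
        ∑[ v ← Vs ] ∑[ b ← vecs d ] 𝟙 (dot b v ≟ᶠ 1F)  ≡⟨ ∑-cong∈ Vs (λ {v} v∈ → hyperplane-≡ (suc n) v 1F (Vs≢𝟎 v∈)) ⟩
        ∑[ v ← Vs ] (q ^ suc n)                        ≡⟨ ∑-const Vs (q ^ suc n) ⟩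
        T * q ^ suc n                                  ∎
        where open ≡-Reasoning

      -- A pair of distinct vectors is met by at most q^n points b, an equal pair by q^(n+1).
      -- Granting q^n to every pair and q^(n+1) more to the equal ones separates the main term from
      -- the energy.
      second-moment : ∑[ b ← vecs d ] (multiplicity b * multiplicity b) ≤ T * (T * q ^ n) + q ^ suc n * energy
      second-moment = begin
        ∑[ b ← vecs d ] (multiplicity b * multiplicity b)
          ≡⟨ ∑-cong (vecs d) (λ b → sym (∑-product Vs Vs (on b) (on b))) ⟩
        ∑[ b ← vecs d ] ∑[ v ← Vs ] ∑[ v′ ← Vs ] (on b v * on b v′)
          ≡⟨ trans (∑-swap (vecs d) Vs _) (∑-cong Vs λ v → ∑-swap (vecs d) Vs _) ⟩
        ∑[ v ← Vs ] ∑[ v′ ← Vs ] ∑[ b ← vecs d ] (on b v * on b v′)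
          ≤⟨ ∑-mono∈ Vs (λ {v} v∈ → ∑-mono Vs λ v′ → pair v v′ (Vs≢𝟎 v∈)) ⟩
        ∑[ v ← Vs ] ∑[ v′ ← Vs ] (q ^ n + q ^ suc n * 𝟙 (v ≟ᵥ v′))
          ≡⟨ ∑-cong Vs (λ v → trans (∑-+ Vs _ _) (cong₂ _+_ (∑-const Vs (q ^ n)) (∑-*ˡ Vs (q ^ suc n) _))) ⟩
        ∑[ v ← Vs ] (T * q ^ n + q ^ suc n * (∑[ v′ ← Vs ] 𝟙 (v ≟ᵥ v′)))
          ≡⟨ trans (∑-+ Vs _ _) (cong₂ _+_ (∑-const Vs (T * q ^ n)) (∑-*ˡ Vs (q ^ suc n) _)) ⟩
        T * (T * q ^ n) + q ^ suc n * energy ∎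
        where
        open ℕ.≤-Reasoning
        on : Vec K d → Vec K d → ℕ
        on b v = 𝟙 (dot b v ≟ᶠ 1F)
        𝟙*𝟙≤𝟙 : {P : Set} (p : Dec P) → 𝟙 p * 𝟙 p ≤ 𝟙 p
        𝟙*𝟙≤𝟙 (yes _) = ℕ.≤-refl
        𝟙*𝟙≤𝟙 (no _)  = ℕ.≤-refl
        pair : ∀ v v′ → ¬ (v ≡ 𝟎) → ∑[ b ← vecs d ] (on b v * on b v′) ≤ q ^ n + q ^ suc n * 𝟙 (v ≟ᵥ v′)
        pair v v′ v≢𝟎 with v ≟ᵥ v′
        ... | no v≢v′  = ℕ.≤-trans (two-hyperplanes-≤ n v v′ v≢𝟎 v≢v′) (ℕ.m≤m+n _ _)
        ... | yes refl = begin
          ∑[ b ← vecs d ] (on b v * on b v)   ≤⟨ ∑-mono (vecs d) (λ b → 𝟙*𝟙≤𝟙 (dot b v ≟ᶠ 1F)) ⟩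
          ∑[ b ← vecs d ] on b v              ≡⟨ hyperplane-≡ (suc n) v 1F v≢𝟎 ⟩
          q ^ suc n                           ≡⟨ ℕ.*-identityʳ (q ^ suc n) ⟨
          q ^ suc n * 1                       ≤⟨ ℕ.m≤n+m _ (q ^ n) ⟩
          q ^ n + q ^ suc n * 1               ∎

      variance-≤ : ∑[ b ← vecs d ] (deviation b * deviation b) ≤ q * (q * (q * q ^ n)) * energy
      -- The amount added on both sides is the cross term of the square. It equals the two T² terms
      -- together, the one from the second moment and the one from the constant, so that only the
      -- energy term survives.
      variance-≤ = ℕ.+-cancelʳ-≤ (2 * (q * (T * (T * q ^ suc n)))) _ _ (begin
        V + 2 * (q * (T * (T * q ^ suc n)))
          ≡⟨ cong (V +_) cross ⟨
        V + (∑[ b ← vecs d ] (2 * (q * f b * T)))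
          ≡⟨ ∑-+ (vecs d) _ _ ⟨
        ∑[ b ← vecs d ] (deviation b * deviation b + 2 * (q * f b * T))
          ≡⟨ ∑-cong (vecs d) (λ b → ∣x-y∣²+2xy (q * f b) T) ⟩
        ∑[ b ← vecs d ] (q * f b * (q * f b) + T * T)
          ≡⟨ trans (∑-+ (vecs d) _ _) (cong₂ _+_ squares (trans (∑-const (vecs d) (T * T)) (cong (_* (T * T)) (length-vecs d)))) ⟩
        q * q * (∑[ b ← vecs d ] (f b * f b)) + q ^ d * (T * T)
          ≤⟨ ℕ.+-monoˡ-≤ _ (ℕ.*-monoʳ-≤ (q * q) second-moment) ⟩
        q * q * (T * (T * q ^ n) + q ^ suc n * energy) + q ^ d * (T * T)
          ≡⟨ collect q T (q ^ n) energy ⟩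
        q * (q * (q * q ^ n)) * energy + 2 * (q * (T * (T * q ^ suc n))) ∎)
        where
        open ℕ.≤-Reasoning
        f = multiplicity
        V = ∑[ b ← vecs d ] (deviation b * deviation b)
        cross : ∑[ b ← vecs d ] (2 * (q * f b * T)) ≡ 2 * (q * (T * (T * q ^ suc n)))
        cross = trans (∑-cong (vecs d) (λ b → regroup q (f b) T)) (trans (∑-*ˡ (vecs d) (2 * (q * T)) f)
          (trans (cong (2 * (q * T) *_) first-moment) (regroup′ q T (q ^ suc n))))
          where
          regroup : ∀ q x t → 2 * (q * x * t) ≡ 2 * (q * t) * x
          regroup = solve-∀
          regroup′ : ∀ q t z → 2 * (q * t) * (t * z) ≡ 2 * (q * (t * (t * z)))
          regroup′ = solve-∀
        squares : ∑[ b ← vecs d ] (q * f b * (q * f b)) ≡ q * q * (∑[ b ← vecs d ] (f b * f b))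
        squares = trans (∑-cong (vecs d) (λ b → regroup q (f b))) (∑-*ˡ (vecs d) (q * q) (λ b → f b * f b))
          where
          regroup : ∀ q x → q * x * (q * x) ≡ q * q * (x * x)
          regroup = solve-∀
        collect : ∀ q t z e → q * q * (t * (t * z) + q * z * e) + q * (q * z) * (t * t)
          ≡ q * (q * (q * z)) * e + 2 * (q * (t * (t * (q * z))))
        collect = solve-∀

    module _ (xs : List K) where

      -- Zero rows give determinant 0, so they are irrelevant to l ≠ 0, and keeping them would make
      -- b = 0 a value of l⁻¹ a for every l.
      rows : List (Vec K d)
      rows = filter (λ a → ¬? (a ≟ᵥ 𝟎)) (allVecs d xs)

      private
        P : ℕ
        P = length rows

      productCount : K → ℕ
      productCount l = ∑[ a ← rows ] ∑[ v ← Vs ] 𝟙 (dot a v ≟ᶠ l)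

      module _ (Vs≢𝟎 : ∀ {v} → v ∈ Vs → ¬ (v ≡ 𝟎)) (uniq : Unique xs) where

        open Moments Vs≢𝟎

        rows-unique : Unique rows
        rows-unique = Unique.filter⁺ _ (allVecs-unique d uniq)

        ∈-rows⁻ : ∀ {a} → a ∈ rows → a ∈ allVecs d xs × ¬ (a ≡ 𝟎)
        ∈-rows⁻ = ∈-filter⁻ (λ a → ¬? (a ≟ᵥ 𝟎)) {xs = allVecs d xs}

        scale-inv : ∀ {l} → ¬ (l ≡ 0F) → {a b : Vec K d} → scale (inv l) a ≡ b → a ≡ scale l b
        scale-inv {l} l≢0 {a} {b} eq = vec-ext λ i → sym (trans (lookup-map i (l ⊗_) b)
          (trans (cong (λ b → l ⊗ lookup b i) (sym eq)) (trans (cong (l ⊗_) (lookup-map i (inv l ⊗_) a)) (inv-cancelʳ l≢0 _))))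

        -- A non-zero b is l⁻¹ a for at most |A| pairs, as l is determined by the entry l bⱼ ∈ A.
        hits-≤ : ∀ b → ∑[ l ← units F ] ∑[ a ← rows ] 𝟙 (scale (inv l) a ≟ᵥ b) ≤ length xs
        hits-≤ b with b ≟ᵥ 𝟎
        ... | yes b≡𝟎 = ℕ.≤-trans (ℕ.≤-reflexive (∑-zero (units F) λ {l} l∈ → ∑-zero rows λ {a} a∈ →
                𝟙-no (scale (inv l) a ≟ᵥ b) λ eq → proj₂ (∈-rows⁻ a∈)
                  (trans (scale-inv (unit≢0 l∈) eq) (trans (cong (scale l) b≡𝟎) (scale-𝟎 l))))) z≤n
          where
          scale-𝟎 : ∀ l → scale l (𝟎 {d}) ≡ 𝟎
          scale-𝟎 l = vec-ext λ i → trans (lookup-map i (l ⊗_) 𝟎) (trans (cong (l ⊗_) (lookup-replicate i 0F))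
            (trans (zeroʳ l) (sym (lookup-replicate i 0F))))
        ... | no b≢𝟎 with nonzero-coordinate b≢𝟎
        ...   | j , bj≢0 = begin
          ∑[ l ← units F ] ∑[ a ← rows ] 𝟙 (scale (inv l) a ≟ᵥ b)
            ≤⟨ ∑-mono∈ (units F) (λ {l} l∈ → entry l (unit≢0 l∈)) ⟩
          ∑[ l ← units F ] ∑[ x ← xs ] 𝟙 (l ⊗ lookup b j ≟ᶠ x)
            ≡⟨ ∑-swap (units F) xs _ ⟩
          ∑[ x ← xs ] ∑[ l ← units F ] 𝟙 (l ⊗ lookup b j ≟ᶠ x)
            ≤⟨ ∑-≤-length xs (λ {x} _ → ∑𝟙≤1 (λ l → l ⊗ lookup b j ≟ᶠ x) units-unique
                 (λ _ _ p p′ → ⊗-cancelʳ bj≢0 (trans p (sym p′)))) ⟩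
          length xs * 1
            ≡⟨ ℕ.*-identityʳ _ ⟩
          length xs ∎
          where
          open ℕ.≤-Reasoning
          entry : ∀ l → ¬ (l ≡ 0F) → ∑[ a ← rows ] 𝟙 (scale (inv l) a ≟ᵥ b) ≤ ∑[ x ← xs ] 𝟙 (l ⊗ lookup b j ≟ᶠ x)
          entry l l≢0 = begin
            ∑[ a ← rows ] 𝟙 (scale (inv l) a ≟ᵥ b)
              ≤⟨ ∑-mono rows (λ a → 𝟙-mono (scale (inv l) a ≟ᵥ b) (scale l b ≟ᵥ a) (λ eq → sym (scale-inv l≢0 eq))) ⟩
            ∑[ a ← rows ] 𝟙 (scale l b ≟ᵥ a)
              ≤⟨ atMost ⟩
            ∑[ x ← xs ] 𝟙 (l ⊗ lookup b j ≟ᶠ x) ∎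
            where
            atMost : ∑[ a ← rows ] 𝟙 (scale l b ≟ᵥ a) ≤ ∑[ x ← xs ] 𝟙 (l ⊗ lookup b j ≟ᶠ x)
            atMost with (∑[ a ← rows ] 𝟙 (scale l b ≟ᵥ a)) in eq
            ... | zero  = z≤n
            ... | suc k with ∑𝟙-witness (λ a → scale l b ≟ᵥ a) rows (subst (1 ≤_) (sym eq) (s≤s z≤n))
            ...   | a , a∈ , refl = begin
              suc k                                        ≡⟨ eq ⟨
              ∑[ a ← rows ] 𝟙 (scale l b ≟ᵥ a)             ≤⟨ ∑𝟙≤1 (λ a → scale l b ≟ᵥ a) rows-unique (λ _ _ p p′ → trans (sym p) p′) ⟩
              1                                            ≡⟨ 𝟙-yes (l ⊗ lookup b j ≟ᶠ lookup (scale l b) j) (sym (lookup-map j (l ⊗_) b)) ⟨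
              𝟙 (l ⊗ lookup b j ≟ᶠ lookup (scale l b) j)   ≤⟨ term≤∑ xs (λ x → 𝟙 (l ⊗ lookup b j ≟ᶠ x)) (∈-allVecs⁻ d (proj₁ (∈-rows⁻ a∈)) j) ⟩
              ∑[ x ← xs ] 𝟙 (l ⊗ lookup b j ≟ᶠ x)          ∎

        productCount-scale : ∀ {l} → ¬ (l ≡ 0F) → productCount l ≡ ∑[ a ← rows ] multiplicity (scale (inv l) a)
        productCount-scale {l} l≢0 = ∑-cong rows λ a → ∑-cong Vs λ v → 𝟙-cong (dot a v ≟ᶠ l) (dot (scale (inv l) a) v ≟ᶠ 1F)
          (λ eq → trans (dot-scaleˡ (inv l) a v) (trans (cong (inv l ⊗_) eq) (inv-inverseˡ l≢0)))
          (λ eq → trans (sym (inv-cancelʳ l≢0 (dot a v))) (trans (cong (l ⊗_) (trans (sym (dot-scaleˡ (inv l) a v)) eq)) (*-identityʳ l)))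

        -- The deviation of `productCount l` from its expected value P T / q, again multiplied by q.
        spread : K → ℕ
        spread l = ∣ q * productCount l - P * T ∣

        spread²-≤ : ∀ {l} → l ∈ units F →
          spread l * spread l ≤ P * (∑[ a ← rows ] (deviation (scale (inv l) a) * deviation (scale (inv l) a)))
        spread²-≤ {l} l∈ = ℕ.≤-trans (ℕ.*-mono-≤ linear linear) (∑-cauchy rows (λ a → deviation (scale (inv l) a)))
          where
          linear : spread l ≤ ∑[ a ← rows ] deviation (scale (inv l) a)
          linear = subst (λ z → ∣ z - P * T ∣ ≤ ∑[ a ← rows ] deviation (scale (inv l) a))
            (trans (∑-*ˡ rows q (λ a → multiplicity (scale (inv l) a))) (cong (q *_) (sym (productCount-scale (unit≢0 l∈)))))
            (∣-∣-∑ rows (λ a → q * multiplicity (scale (inv l) a)) T)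

        ∑-spread²-≤ : ∑[ l ← units F ] (spread l * spread l) ≤ P * (length xs * (q * (q * (q * q ^ n)) * energy))
        ∑-spread²-≤ = begin
          ∑[ l ← units F ] (spread l * spread l)
            ≤⟨ ∑-mono∈ (units F) spread²-≤ ⟩
          ∑[ l ← units F ] (P * (∑[ a ← rows ] y² (scale (inv l) a)))
            ≡⟨ ∑-*ˡ (units F) P _ ⟩
          P * (∑[ l ← units F ] ∑[ a ← rows ] y² (scale (inv l) a))
            -- A sum over b = l⁻¹ a is introduced and moved outermost, so that the inner count of
            -- pairs (l , a) is the one bounded by `hits-≤`.
            ≡⟨ cong (P *_) (∑-cong (units F) λ l → ∑-cong rows λ a → sym (∑-δ _≟ᵥ_ (vecs-unique d) (∈-vecs (scale (inv l) a)) y²)) ⟩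
          P * (∑[ l ← units F ] ∑[ a ← rows ] ∑[ b ← vecs d ] (𝟙 (scale (inv l) a ≟ᵥ b) * y² b))
            ≡⟨ cong (P *_) (trans (∑-cong (units F) λ l → ∑-swap rows (vecs d) _) (∑-swap (units F) (vecs d) _)) ⟩
          P * (∑[ b ← vecs d ] ∑[ l ← units F ] ∑[ a ← rows ] (𝟙 (scale (inv l) a ≟ᵥ b) * y² b))
            ≡⟨ cong (P *_) (∑-cong (vecs d) λ b → trans (∑-cong (units F) λ l → ∑-*ʳ rows _ (y² b)) (∑-*ʳ (units F) _ (y² b))) ⟩
          P * (∑[ b ← vecs d ] ((∑[ l ← units F ] ∑[ a ← rows ] 𝟙 (scale (inv l) a ≟ᵥ b)) * y² b))
            ≤⟨ ℕ.*-monoʳ-≤ P (∑-mono (vecs d) λ b → ℕ.*-monoˡ-≤ (y² b) (hits-≤ b)) ⟩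
          P * (∑[ b ← vecs d ] (length xs * y² b))
            ≡⟨ cong (P *_) (∑-*ˡ (vecs d) (length xs) y²) ⟩
          P * (length xs * ∑ (vecs d) y²)
            ≤⟨ ℕ.*-monoʳ-≤ P (ℕ.*-monoʳ-≤ (length xs) variance-≤) ⟩
          P * (length xs * (q * (q * (q * q ^ n)) * energy)) ∎
          where
          open ℕ.≤-Reasoning
          y² : Vec K d → ℕ
          y² b = deviation b * deviation b

        ∑-productCount-≤ : ∑ (units F) productCount ≤ P * T
        ∑-productCount-≤ = begin
          ∑[ l ← units F ] ∑[ a ← rows ] ∑[ v ← Vs ] 𝟙 (dot a v ≟ᶠ l)
            ≡⟨ trans (∑-swap (units F) rows _) (∑-cong rows λ a → ∑-swap (units F) Vs _) ⟩
          ∑[ a ← rows ] ∑[ v ← Vs ] ∑[ l ← units F ] 𝟙 (dot a v ≟ᶠ l)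
            ≤⟨ ∑-≤-length rows (λ {a} _ → ∑-≤-length Vs λ {v} _ → ∑𝟙≤1 (dot a v ≟ᶠ_) units-unique (λ _ _ p p′ → trans (sym p) p′)) ⟩
          P * (T * 1)
            ≡⟨ cong (P *_) (ℕ.*-identityʳ T) ⟩
          P * T ∎
          where open ℕ.≤-Reasoning

        -- Write Z = (P T)², and let H bound the sum of squared spreads. Expanding the squares gives
        -- q² L + U Z ≤ H + 2 q Z, where U ≥ q - 1 is the number of units; so 2 q - (q - 1) = q + 1
        -- copies of Z remain. Adding q Z to both sides avoids the subtraction.
        sieve : q * q * (∑[ l ← units F ] (productCount l * productCount l))
          ≤ (q + 1) * (P * T * (P * T)) + P * (length xs * (q * (q * (q * q ^ n)) * energy))
        sieve = ℕ.+-cancelʳ-≤ (q * Z) _ _ (begin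
          q * q * L + q * Z
            ≤⟨ ℕ.+-monoʳ-≤ (q * q * L) (ℕ.*-monoˡ-≤ Z q≤1+#units) ⟩
          q * q * L + (1 + U) * Z
            ≡⟨ shuffle (q * q * L) Z (U * Z) ⟩
          q * q * L + U * Z + Z
            ≡⟨ cong (_+ Z) expansion ⟨
          ∑[ l ← units F ] (spread l * spread l) + ∑[ l ← units F ] (2 * (q * r l * (P * T))) + Z
            ≤⟨ ℕ.+-monoˡ-≤ Z (ℕ.+-mono-≤ ∑-spread²-≤ cross) ⟩
          H + 2 * (q * (P * T * (P * T))) + Z
            ≡⟨ collect H q Z ⟩
          (q + 1) * Z + H + q * Z ∎)
          where
          open ℕ.≤-Reasoning
          r = productCount
          L = ∑[ l ← units F ] (r l * r l)
          U = length (units F)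
          Z = P * T * (P * T)
          H = P * (length xs * (q * (q * (q * q ^ n)) * energy))
          shuffle : ∀ a z u → a + (z + u) ≡ a + u + z
          shuffle = solve-∀
          collect : ∀ h q z → h + 2 * (q * z) + z ≡ (q + 1) * z + h + q * z
          collect = solve-∀
          expansion : ∑[ l ← units F ] (spread l * spread l) + ∑[ l ← units F ] (2 * (q * r l * (P * T))) ≡ q * q * L + U * Z
          expansion = trans (sym (∑-+ (units F) _ _)) (trans (∑-cong (units F) (λ l → ∣x-y∣²+2xy (q * r l) (P * T)))
            (trans (∑-+ (units F) _ _) (cong₂ _+_
              (trans (∑-cong (units F) (λ l → regroup q (r l))) (∑-*ˡ (units F) (q * q) (λ l → r l * r l)))
              (∑-const (units F) Z))))
            where
            regroup : ∀ q x → q * x * (q * x) ≡ q * q * (x * x)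
            regroup = solve-∀
          cross : ∑[ l ← units F ] (2 * (q * r l * (P * T))) ≤ 2 * (q * (P * T * (P * T)))
          cross = begin
            ∑[ l ← units F ] (2 * (q * r l * (P * T)))    ≡⟨ ∑-cong (units F) (λ l → regroup q (r l) (P * T)) ⟩
            ∑[ l ← units F ] (2 * (q * (P * T)) * r l)    ≡⟨ ∑-*ˡ (units F) (2 * (q * (P * T))) r ⟩
            2 * (q * (P * T)) * ∑ (units F) r             ≤⟨ ℕ.*-monoʳ-≤ (2 * (q * (P * T))) ∑-productCount-≤ ⟩
            2 * (q * (P * T)) * (P * T)                   ≡⟨ regroup′ q (P * T) ⟩
            2 * (q * (P * T * (P * T)))                   ∎
            where
            regroup : ∀ q x w → 2 * (q * x * w) ≡ 2 * (q * w) * x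
            regroup = solve-∀
            regroup′ : ∀ q w → 2 * (q * w) * w ≡ 2 * (q * (w * w))
            regroup′ = solve-∀

-- From matrices over A to incidences: the explicit inequality

module Bound {q : ℕ} (F : FiniteField q) (A : Subset q) where
  open import Data.Nat using (_+_; _≤_; _<_; z≤n; s≤s; ∣_-_∣)
  open Sums
  open LinearAlgebra F
  open Counting F
  open Sieve F

  private
    xs : List K
    xs = elems F A
    a : ℕ
    a = ∣ A ∣

  elems-unique : Unique xs
  elems-unique = Unique.filter⁺ (_∈? A) (Unique.allFin⁺ q)

  length-elems : length xs ≡ a
  length-elems = trans (length-filter-∑ (_∈? A) (allFin q)) (∑-subset A)

  N≡detCount : (k : ℕ) (t : K) → N F k A t ≡ detCount xs k t
  N≡detCount k t = trans (length-filter-∑ (λ M → det F k M ≟ᶠ t) (allFuns k (allFuns k xs)))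
    (∑-Pointwise (allFuns-allVecs (Represents _≡_) k (allFuns-allVecs _≡_ k (Pointwise.refl refl)))
      (λ {M} {B} rep → cong (λ x → 𝟙 (x ≟ᶠ t)) (det-cong k rep)))

  module _ (m : ℕ) where

    private
      n : ℕ
      n = suc m
      d : ℕ
      d = suc n
      Ms : List (Vec (Vec K d) n)
      Ms = wideMatrices xs n

    -- A list with repetitions, one entry for each matrix with non-zero cofactor vector, so that its
    -- energy counts pairs of matrices.
    nonzeroCofactors : List (Vec K d)
    nonzeroCofactors = filter (λ v → ¬? (v ≟ᵥ 𝟎)) (map cofactors Ms)

    nonzeroCofactors≢𝟎 : ∀ {v} → v ∈ nonzeroCofactors → ¬ (v ≡ 𝟎)
    nonzeroCofactors≢𝟎 v∈ = proj₂ (∈-filter⁻ (λ v → ¬? (v ≟ᵥ 𝟎)) {xs = map cofactors Ms} v∈)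

    private
      Vs : List (Vec K d)
      Vs = nonzeroCofactors

    ∑-nonzeroCofactors : (f : Vec K d → ℕ) → ∑ Vs f ≡ ∑[ M ← Ms ] (𝟙 (¬? (cofactors M ≟ᵥ 𝟎)) * f (cofactors M))
    ∑-nonzeroCofactors f = trans (∑-filter (λ v → ¬? (v ≟ᵥ 𝟎)) (map cofactors Ms) f) (∑-map cofactors Ms _)

    energy-≤ : energy m Vs ≤ cofactorEnergy xs m
    energy-≤ = begin
      ∑[ v ← Vs ] ∑[ v′ ← Vs ] 𝟙 (v ≟ᵥ v′)
        ≡⟨ ∑-nonzeroCofactors _ ⟩
      ∑[ M ← Ms ] (nz M * (∑[ v′ ← Vs ] 𝟙 (cofactors M ≟ᵥ v′)))
        ≡⟨ ∑-cong Ms (λ M → cong (nz M *_) (∑-nonzeroCofactors _)) ⟩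
      ∑[ M ← Ms ] (nz M * (∑[ M′ ← Ms ] (nz M′ * 𝟙 (cofactors M ≟ᵥ cofactors M′))))
        ≡⟨ ∑-cong Ms (λ M → sym (∑-*ˡ Ms (nz M) _)) ⟩
      ∑[ M ← Ms ] ∑[ M′ ← Ms ] (nz M * (nz M′ * 𝟙 (cofactors M ≟ᵥ cofactors M′)))
        ≤⟨ ∑-mono Ms (λ M → ∑-mono Ms λ M′ → term (¬? (cofactors M ≟ᵥ 𝟎)) (¬? (cofactors M′ ≟ᵥ 𝟎)) (cofactors M ≟ᵥ cofactors M′)) ⟩
      cofactorEnergy xs m ∎
      where
      open ℕ.≤-Reasoning
      nz : Vec (Vec K d) n → ℕ
      nz M = 𝟙 (¬? (cofactors M ≟ᵥ 𝟎))
      term : {P P′ Q : Set} (p : Dec P) (p′ : Dec P′) (e : Dec Q) → 𝟙 p * (𝟙 p′ * 𝟙 e) ≤ 𝟙 (e ×-dec p)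
      term (no _)  _       _       = z≤n
      term (yes _) (no _)  _       = z≤n
      term (yes _) (yes _) (no _)  = z≤n
      term (yes _) (yes _) (yes _) = ℕ.≤-refl

    -- If r · v = l with l ≠ 0, then neither r nor v is zero, so no matrix counted on the left is
    -- lost by the two filters.
    N≤productCount : ∀ {l} → ¬ (l ≡ 0F) → N F d A l ≤ productCount m Vs xs l
    N≤productCount {l} l≢0 = begin
      N F d A l
        ≡⟨ N≡detCount d l ⟩
      ∑[ B ← allVecs d (allVecs d xs) ] 𝟙 (det F d (entries B) ≟ᶠ l)
        ≡⟨ ∑-allVecs-suc n (allVecs d xs) (λ B → 𝟙 (det F d (entries B) ≟ᶠ l)) ⟩
      ∑[ r ← allVecs d xs ] ∑[ M ← Ms ] 𝟙 (det F d (entries (r ∷ M)) ≟ᶠ l)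
        ≤⟨ ∑-mono (allVecs d xs) (λ r → ∑-mono Ms λ M → term r M) ⟩
      ∑[ r ← allVecs d xs ] ∑[ M ← Ms ] (𝟙 (¬? (r ≟ᵥ 𝟎)) * (𝟙 (¬? (cofactors M ≟ᵥ 𝟎)) * 𝟙 (dot r (cofactors M) ≟ᶠ l)))
        ≡⟨ ∑-cong (allVecs d xs) (λ r → ∑-*ˡ Ms (𝟙 (¬? (r ≟ᵥ 𝟎))) _) ⟩
      ∑[ r ← allVecs d xs ] (𝟙 (¬? (r ≟ᵥ 𝟎)) * (∑[ M ← Ms ] (𝟙 (¬? (cofactors M ≟ᵥ 𝟎)) * 𝟙 (dot r (cofactors M) ≟ᶠ l))))
        ≡⟨ ∑-cong (allVecs d xs) (λ r → cong (𝟙 (¬? (r ≟ᵥ 𝟎)) *_) (sym (∑-nonzeroCofactors (λ v → 𝟙 (dot r v ≟ᶠ l))))) ⟩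
      ∑[ r ← allVecs d xs ] (𝟙 (¬? (r ≟ᵥ 𝟎)) * (∑[ v ← Vs ] 𝟙 (dot r v ≟ᶠ l)))
        ≡⟨ ∑-filter (λ r → ¬? (r ≟ᵥ 𝟎)) (allVecs d xs) (λ r → ∑[ v ← Vs ] 𝟙 (dot r v ≟ᶠ l)) ⟨
      productCount m Vs xs l ∎
      where
      open ℕ.≤-Reasoning
      term : ∀ r M → 𝟙 (det F d (entries (r ∷ M)) ≟ᶠ l) ≤ 𝟙 (¬? (r ≟ᵥ 𝟎)) * (𝟙 (¬? (cofactors M ≟ᵥ 𝟎)) * 𝟙 (dot r (cofactors M) ≟ᶠ l))
      term r M = 𝟙-elim (det F d (entries (r ∷ M)) ≟ᶠ l) λ det≡l →
        let dot≡l = trans (sym (det-∷ r M)) det≡l in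
        ℕ.≤-reflexive (sym (cong₂ _*_
          (𝟙-yes (¬? (r ≟ᵥ 𝟎)) λ r≡𝟎 → l≢0 (trans (sym dot≡l) (trans (cong (λ r → dot r (cofactors M)) r≡𝟎) (dot-𝟎ˡ (cofactors M)))))
          (cong₂ _*_
            (𝟙-yes (¬? (cofactors M ≟ᵥ 𝟎)) λ v≡𝟎 → l≢0 (trans (sym dot≡l) (trans (cong (dot r) v≡𝟎) (dot-𝟎ʳ r))))
            (𝟙-yes (dot r (cofactors M) ≟ᶠ l) dot≡l))))

    private
      S : ℕ
      S = sumSqN F n A

    detEnergy≡sumSqN : (k : ℕ) → detEnergy xs k ≡ sumSqN F k A
    detEnergy≡sumSqN k = ∑-cong (units F) λ t → cong₂ _*_ (sym (N≡detCount k t)) (sym (N≡detCount k t))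

    rows*cofactors≤ : length (rows m Vs xs) * length Vs ≤ (a ^ d) ^ d
    rows*cofactors≤ = ℕ.*-mono-≤ rows≤ (begin
      length Vs                       ≤⟨ length-filter _ (map cofactors Ms) ⟩
      length (map cofactors Ms)       ≡⟨ length-map cofactors Ms ⟩
      length Ms                       ≡⟨ length-allVecs n (allVecs d xs) ⟩
      length (allVecs d xs) ^ n       ≡⟨ cong (_^ n) (trans (length-allVecs d xs) (cong (_^ d) length-elems)) ⟩
      (a ^ d) ^ n                     ∎)
      where
      open ℕ.≤-Reasoning
      rows≤ : length (rows m Vs xs) ≤ a ^ d
      rows≤ = ℕ.≤-trans (length-filter _ (allVecs d xs)) (ℕ.≤-reflexive (trans (length-allVecs d xs) (cong (_^ d) length-elems)))

    -- The quantitative form of the theorem, multiplied by q². The factor q + 1 is q (1 + 1/q), and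
    -- a^d a^n (a + n) is a^(2d) (1 + n/a) for a ≠ 0, with n = d - 1.
    sumSqN-≤ : q * q * sumSqN F d A ≤ (q + 1) * a ^ (2 * (d * d)) + q * q * (q ^ n * (a ^ d * (a ^ n * ((a + n) * S))))
    sumSqN-≤ = begin
      q * q * sumSqN F d A
        ≤⟨ ℕ.*-monoʳ-≤ (q * q) (∑-mono∈ (units F) λ l∈ → let le = N≤productCount (unit≢0 l∈) in ℕ.*-mono-≤ le le) ⟩
      q * q * (∑[ l ← units F ] (productCount m Vs xs l * productCount m Vs xs l))
        ≤⟨ sieve m Vs xs nonzeroCofactors≢𝟎 elems-unique ⟩
      (q + 1) * (PT * PT) + P * (length xs * (q * (q * (q * q ^ m)) * energy m Vs))
        ≤⟨ ℕ.+-mono-≤ (ℕ.*-monoʳ-≤ (q + 1) main) error ⟩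
      (q + 1) * a ^ (2 * (d * d)) + q * q * (q ^ n * (a ^ d * (a ^ n * ((a + n) * S)))) ∎
      where
      open ℕ.≤-Reasoning
      P = length (rows m Vs xs)
      PT = P * length Vs
      main : PT * PT ≤ a ^ (2 * (d * d))
      main = begin
        PT * PT                        ≤⟨ ℕ.*-mono-≤ rows*cofactors≤ rows*cofactors≤ ⟩
        (a ^ d) ^ d * (a ^ d) ^ d      ≡⟨ cong₂ _*_ (ℕ.^-*-assoc a d d) (ℕ.^-*-assoc a d d) ⟩
        a ^ (d * d) * a ^ (d * d)      ≡⟨ ℕ.^-distribˡ-+-* a (d * d) (d * d) ⟨
        a ^ (d * d + d * d)            ≡⟨ cong (λ e → a ^ (d * d + e)) (ℕ.+-identityʳ (d * d)) ⟨
        a ^ (2 * (d * d))              ∎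
      P≤ : P ≤ a ^ d
      P≤ = ℕ.≤-trans (length-filter _ (allVecs d xs)) (ℕ.≤-reflexive (trans (length-allVecs d xs) (cong (_^ d) length-elems)))
      energy-bound : energy m Vs ≤ S * a ^ n + n * (S * a ^ m)
      energy-bound = ℕ.≤-trans energy-≤ (subst₂ (λ s b → cofactorEnergy xs m ≤ s * b ^ n + n * (s * b ^ m))
        (detEnergy≡sumSqN n) length-elems (cofactorEnergy-≤ xs m elems-unique))
      error : P * (length xs * (q * (q * (q * q ^ m)) * energy m Vs)) ≤ q * q * (q ^ n * (a ^ d * (a ^ n * ((a + n) * S))))
      error = begin
        P * (length xs * (q * (q * (q * q ^ m)) * energy m Vs))
          ≤⟨ ℕ.*-mono-≤ P≤ (ℕ.*-mono-≤ (ℕ.≤-reflexive length-elems) (ℕ.*-monoʳ-≤ (q * (q * (q * q ^ m))) energy-bound)) ⟩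
        a ^ d * (a * (q * (q * (q * q ^ m)) * (S * a ^ n + n * (S * a ^ m))))
          ≡⟨ regroup (a ^ d) a q (q ^ m) S (a ^ m) n ⟩
        q * q * (q ^ n * (a ^ d * (a ^ n * ((a + n) * S)))) ∎
        where
        regroup : ∀ u a q z s w n → u * (a * (q * (q * (q * z)) * (s * (a * w) + n * (s * w)))) ≡ q * q * (q * z * (u * (a * w * ((a + n) * s))))
        regroup = solve-∀

-- Passage to rational numbers and the choice of the threshold

module ClearingDenominators where
  open import Data.Nat using (_+_; _≤_)
  open import Data.Integer as ℤ using (+_)
  import Data.Integer.Properties as ℤ

  -- Since `_/_` reduces fractions to lowest terms, identities between rationals are checked on
  -- unnormalised fractions.
  toℚᵘ-/ : ∀ i k → toℚᵘ (i / suc k) ℚᵘ.≃ mkℚᵘ i k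
  toℚᵘ-/ i k = ℚ.toℚᵘ-fromℚᵘ (mkℚᵘ i k)

  ℕ→ℚ-+ : ∀ m n → ℕ→ℚ (m + n) ≡ ℕ→ℚ m ℚ.+ ℕ→ℚ n
  ℕ→ℚ-+ m n = ℚ.toℚᵘ-injective (begin
    toℚᵘ (ℕ→ℚ (m + n))               ≈⟨ toℚᵘ-/ (+ (m + n)) 0 ⟩
    mkℚᵘ (+ (m + n)) 0               ≈⟨ ℚᵘ.*≡* (cong (ℤ._* + 1) (cong₂ ℤ._+_ (sym (ℤ.*-identityʳ (+ m))) (sym (ℤ.*-identityʳ (+ n))))) ⟩
    mkℚᵘ (+ m) 0 ℚᵘ.+ mkℚᵘ (+ n) 0   ≈⟨ ℚᵘ.+-cong (toℚᵘ-/ (+ m) 0) (toℚᵘ-/ (+ n) 0) ⟨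
    toℚᵘ (ℕ→ℚ m) ℚᵘ.+ toℚᵘ (ℕ→ℚ n)   ≈⟨ ℚ.toℚᵘ-homo-+ (ℕ→ℚ m) (ℕ→ℚ n) ⟨
    toℚᵘ (ℕ→ℚ m ℚ.+ ℕ→ℚ n)           ∎)
    where open ℚᵘ.≃-Reasoning

  /-*-/ : ∀ i j k → (i / 1) ℚ.* (j / suc k) ≡ (i ℤ.* j) / suc k
  /-*-/ i j k = ℚ.toℚᵘ-injective (begin
    toℚᵘ ((i / 1) ℚ.* (j / suc k))            ≈⟨ ℚ.toℚᵘ-homo-* (i / 1) (j / suc k) ⟩
    toℚᵘ (i / 1) ℚᵘ.* toℚᵘ (j / suc k)        ≈⟨ ℚᵘ.*-cong (toℚᵘ-/ i 0) (toℚᵘ-/ j k) ⟩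
    mkℚᵘ i 0 ℚᵘ.* mkℚᵘ j k                    ≈⟨ ℚᵘ.*≡* (cong (λ d → i ℤ.* j ℤ.* + suc d) (sym (ℕ.+-identityʳ k))) ⟩
    mkℚᵘ (i ℤ.* j) k                          ≈⟨ toℚᵘ-/ (i ℤ.* j) k ⟨
    toℚᵘ ((i ℤ.* j) / suc k)                  ∎)
    where open ℚᵘ.≃-Reasoning

  ℕ→ℚ-* : ∀ m n → ℕ→ℚ (m * n) ≡ ℕ→ℚ m ℚ.* ℕ→ℚ n
  ℕ→ℚ-* m n = trans (cong (_/ 1) (ℤ.pos-* m n)) (sym (/-*-/ (+ m) (+ n) 0))

  ℕ→ℚ-mono-≤ : ∀ {m n} → m ≤ n → ℕ→ℚ m ℚ.≤ ℕ→ℚ n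
  ℕ→ℚ-mono-≤ {m} {n} m≤n = ℚ.toℚᵘ-cancel-≤ (begin
    toℚᵘ (ℕ→ℚ m)   ≃⟨ toℚᵘ-/ (+ m) 0 ⟩
    mkℚᵘ (+ m) 0   ≤⟨ ℚᵘ.*≤* (ℤ.*-monoʳ-≤-nonNeg (+ 1) (ℤ.+≤+ m≤n)) ⟩
    mkℚᵘ (+ n) 0   ≃⟨ toℚᵘ-/ (+ n) 0 ⟨
    toℚᵘ (ℕ→ℚ n)   ∎)
    where open ℚᵘ.≤-Reasoning

  ℕ→ℚ-*-/ : ∀ k n → ℕ→ℚ (suc k) ℚ.* ((+ n) / suc k) ≡ ℕ→ℚ n
  ℕ→ℚ-*-/ k n = trans (/-*-/ (+ suc k) (+ n) k) (ℚ.toℚᵘ-injective (begin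
    toℚᵘ ((+ suc k ℤ.* + n) / suc k)   ≈⟨ toℚᵘ-/ (+ suc k ℤ.* + n) k ⟩
    mkℚᵘ (+ suc k ℤ.* + n) k           ≈⟨ ℚᵘ.*≡* (trans (ℤ.*-identityʳ (+ suc k ℤ.* + n)) (ℤ.*-comm (+ suc k) (+ n))) ⟩
    mkℚᵘ (+ n) 0                       ≈⟨ toℚᵘ-/ (+ n) 0 ⟨
    toℚᵘ (ℕ→ℚ n)                       ∎))
    where open ℚᵘ.≃-Reasoning

  -- Multiplication by (k + 1) q clears the denominators of both ε and 1 / q, which turns the
  -- hypothesis into the conclusion.
  clear-denominators : ∀ k e q .{{_ : NonZero q}} L Z Y S →
    suc k * (q * L) ≤ (suc k + e) * Z + q * ((suc k + e) * (Y * S)) →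
    let ε = (+ e) / suc k in
    ℕ→ℚ L ℚ.≤ ((1ℚ ℚ.+ ε) ℚ.* (ℕ→ℚ Z ℚ.* ((+ 1) / q))) ℚ.+ (ℕ→ℚ Y ℚ.* (1ℚ ℚ.+ ε) ℚ.* ℕ→ℚ S)
  clear-denominators k e q@(suc q-1) L Z Y S h = ℚ.*-cancelˡ-≤-pos (ℕ→ℚ (suc k * q)) {{ℚ.normalize-pos (suc k * q) 1}} (begin
    ℕ→ℚ (suc k * q) ℚ.* ℕ→ℚ L
      ≡⟨ ℕ→ℚ-* (suc k * q) L ⟨
    ℕ→ℚ (suc k * q * L)
      ≡⟨ cong ℕ→ℚ (ℕ.*-assoc (suc k) q L) ⟩
    ℕ→ℚ (suc k * (q * L))
      ≤⟨ ℕ→ℚ-mono-≤ h ⟩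
    ℕ→ℚ ((suc k + e) * Z + q * ((suc k + e) * (Y * S)))
      ≡⟨ ℕ→ℚ-+ ((suc k + e) * Z) (q * ((suc k + e) * (Y * S))) ⟩
    ℕ→ℚ ((suc k + e) * Z) ℚ.+ ℕ→ℚ (q * ((suc k + e) * (Y * S)))
      ≡⟨ cong₂ ℚ._+_ (ℕ→ℚ-* (suc k + e) Z)
           (trans (ℕ→ℚ-* q ((suc k + e) * (Y * S))) (cong (ℕ→ℚ q ℚ.*_) (trans (ℕ→ℚ-* (suc k + e) (Y * S)) (cong (ℕ→ℚ (suc k + e) ℚ.*_) (ℕ→ℚ-* Y S))))) ⟩
    ℕ→ℚ (suc k + e) ℚ.* z ℚ.+ r ℚ.* (ℕ→ℚ (suc k + e) ℚ.* (y ℚ.* s))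
      ≡⟨ cong₂ (λ u v → u ℚ.* z ℚ.+ r ℚ.* (u ℚ.* (y ℚ.* s))) (trans (ℕ→ℚ-+ (suc k) e) (cong (t ℚ.+_) (sym (ℕ→ℚ-*-/ k e)))) (refl {x = 1ℚ}) ⟩
    (t ℚ.+ t ℚ.* ε) ℚ.* z ℚ.+ r ℚ.* ((t ℚ.+ t ℚ.* ε) ℚ.* (y ℚ.* s))
      -- A factor 1 is inserted in order to be rewritten as q · (1 / q).
      ≡⟨ cong (ℚ._+ r ℚ.* ((t ℚ.+ t ℚ.* ε) ℚ.* (y ℚ.* s))) (ℚ.*-identityʳ ((t ℚ.+ t ℚ.* ε) ℚ.* z)) ⟨
    (t ℚ.+ t ℚ.* ε) ℚ.* z ℚ.* 1ℚ ℚ.+ r ℚ.* ((t ℚ.+ t ℚ.* ε) ℚ.* (y ℚ.* s))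
      ≡⟨ cong (λ u → (t ℚ.+ t ℚ.* ε) ℚ.* z ℚ.* u ℚ.+ r ℚ.* ((t ℚ.+ t ℚ.* ε) ℚ.* (y ℚ.* s))) (ℕ→ℚ-*-/ q-1 1) ⟨
    (t ℚ.+ t ℚ.* ε) ℚ.* z ℚ.* (r ℚ.* i) ℚ.+ r ℚ.* ((t ℚ.+ t ℚ.* ε) ℚ.* (y ℚ.* s))
      ≡⟨ rearrange t r ε z i y s ⟩
    t ℚ.* r ℚ.* ((1ℚ ℚ.+ ε) ℚ.* (z ℚ.* i) ℚ.+ y ℚ.* (1ℚ ℚ.+ ε) ℚ.* s)
      ≡⟨ cong (ℚ._* ((1ℚ ℚ.+ ε) ℚ.* (z ℚ.* i) ℚ.+ y ℚ.* (1ℚ ℚ.+ ε) ℚ.* s)) (ℕ→ℚ-* (suc k) q) ⟨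
    ℕ→ℚ (suc k * q) ℚ.* ((1ℚ ℚ.+ ε) ℚ.* (z ℚ.* i) ℚ.+ y ℚ.* (1ℚ ℚ.+ ε) ℚ.* s) ∎)
    where
    open ℚ.≤-Reasoning
    ε t r z y s i : ℚ
    ε = (+ e) / suc k
    t = ℕ→ℚ (suc k)
    r = ℕ→ℚ q
    z = ℕ→ℚ Z
    y = ℕ→ℚ Y
    s = ℕ→ℚ S
    i = (+ 1) / q
    rearrange : ∀ t r ε z i y s →
      (t ℚ.+ t ℚ.* ε) ℚ.* z ℚ.* (r ℚ.* i) ℚ.+ r ℚ.* ((t ℚ.+ t ℚ.* ε) ℚ.* (y ℚ.* s))
        ≡ t ℚ.* r ℚ.* ((1ℚ ℚ.+ ε) ℚ.* (z ℚ.* i) ℚ.+ y ℚ.* (1ℚ ℚ.+ ε) ℚ.* s)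
    rearrange = solve 7 (λ t r ε z i y s →
      (t :+ t :* ε) :* z :* (r :* i) :+ r :* ((t :+ t :* ε) :* (y :* s))
        := t :* r :* ((con 1ℚ :+ ε) :* (z :* i) :+ y :* (con 1ℚ :+ ε) :* s)) refl
      where open +-*-Solver

  -- The second hypothesis on a absorbs the factor 1 + n / a into 1 + e / t, the first one 1 + 1 / q.
  absorb-error : ∀ t e q a n L Z R W S .{{_ : NonZero q}} → t ≤ q * e → t * n ≤ a * e →
    q * q * L ≤ (q + 1) * Z + q * q * (R * (W * ((a + n) * S))) →
    t * (q * L) ≤ (t + e) * Z + q * ((t + e) * (R * (W * a) * S))
  absorb-error t e q a n L Z R W S t≤qe tn≤ae h = ℕ.*-cancelˡ-≤ q (begin
    q * (t * (q * L))                                                ≡⟨ e₁ q t L ⟩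
    t * (q * q * L)                                                  ≤⟨ ℕ.*-monoʳ-≤ t h ⟩
    t * ((q + 1) * Z + q * q * (R * (W * ((a + n) * S))))            ≡⟨ e₂ t q Z R W a n S ⟩
    (t * q + t) * Z + q * q * (R * (W * ((a * t + t * n) * S)))
      ≤⟨ ℕ.+-mono-≤ (ℕ.*-monoˡ-≤ Z (ℕ.+-monoʳ-≤ (t * q) t≤qe))
           (ℕ.*-monoʳ-≤ (q * q) (ℕ.*-monoʳ-≤ R (ℕ.*-monoʳ-≤ W (ℕ.*-monoˡ-≤ S (ℕ.+-monoʳ-≤ (a * t) tn≤ae))))) ⟩
    (t * q + q * e) * Z + q * q * (R * (W * ((a * t + a * e) * S)))  ≡⟨ e₃ t q Z R W a e S ⟩
    q * ((t + e) * Z + q * ((t + e) * (R * (W * a) * S)))            ∎)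
    where
    open ℕ.≤-Reasoning
    e₁ : ∀ q t L → q * (t * (q * L)) ≡ t * (q * q * L)
    e₁ = solve-∀
    e₂ : ∀ t q Z R W a n S → t * ((q + 1) * Z + q * q * (R * (W * ((a + n) * S)))) ≡ (t * q + t) * Z + q * q * (R * (W * ((a * t + t * n) * S)))
    e₂ = solve-∀
    e₃ : ∀ t q Z R W a e S → (t * q + q * e) * Z + q * q * (R * (W * ((a * t + a * e) * S))) ≡ q * ((t + e) * Z + q * ((t + e) * (R * (W * a) * S)))
    e₃ = solve-∀

  -- As the numerator of ε is at least 1, ε ≥ 1 / (k + 1). The hypothesis gives n / |A| ≤ 1 / (k +
  -- 1), and |A| ≤ q then gives 1 / q ≤ 1 / (k + 1); so ε dominates both errors.
  bound : (m k e q : ℕ) .{{_ : NonZero q}} (F : FiniteField q) (A : Subset q) → suc k * suc m ≤ ∣ A ∣ →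
    let d = suc (suc m) ; ε = (+ suc e) / suc k in
    ℕ→ℚ (sumSqN F d A) ℚ.≤ ((1ℚ ℚ.+ ε) ℚ.* (ℕ→ℚ (∣ A ∣ ^ (2 * (d * d))) ℚ.* ((+ 1) / q)))
      ℚ.+ (ℕ→ℚ (q ^ suc m * ∣ A ∣ ^ (2 * d)) ℚ.* (1ℚ ℚ.+ ε) ℚ.* ℕ→ℚ (sumSqN F (suc m) A))
  bound m k e q F A M≤a = clear-denominators k (suc e) q (sumSqN F d A) (a ^ (2 * (d * d))) (q ^ n * a ^ (2 * d)) (sumSqN F n A)
    (subst (λ w → suc k * (q * sumSqN F d A) ≤ (suc k + suc e) * a ^ (2 * (d * d)) + q * ((suc k + suc e) * (q ^ n * w * sumSqN F n A)))
      power
      (absorb-error (suc k) (suc e) q a n (sumSqN F d A) (a ^ (2 * (d * d))) (q ^ n) (a ^ d * a ^ n) (sumSqN F n A)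
        (ℕ.≤-trans (ℕ.≤-trans (ℕ.m≤m*n (suc k) (suc m)) (ℕ.≤-trans M≤a (∣p∣≤n A))) (ℕ.m≤m*n q (suc e)))
        (ℕ.≤-trans M≤a (ℕ.m≤m*n a (suc e)))
        (subst (λ w → q * q * sumSqN F d A ≤ (q + 1) * a ^ (2 * (d * d)) + q * q * (q ^ n * w))
          (sym (ℕ.*-assoc (a ^ d) (a ^ n) _)) (Bound.sumSqN-≤ F A m))))
    where
    n d a : ℕ
    n = suc m
    d = suc n
    a = ∣ A ∣
    power : a ^ d * a ^ n * a ≡ a ^ (2 * d)
    power = trans (regroup (a ^ d) (a ^ n) a) (trans (sym (ℕ.^-distribˡ-+-* a d d)) (cong (λ j → a ^ (d + j)) (sym (ℕ.+-identityʳ d))))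
      where
      regroup : ∀ u v a → u * v * a ≡ u * (a * v)
      regroup = solve-∀

-- The asymptotic statement

open import Data.Nat using (ℕ; _≥_; _^_; _∸_; _*_; NonZero; s≤s)
open import Data.Nat.Primality using (Prime)
open import Data.Integer as ℤ using (+_; -[1+_])
open import Data.Rational using (ℚ; _<_; _≤_; _+_; _/_; 0ℚ; 1ℚ) renaming (_*_ to _*ℚ_)

theorem8 : (d : ℕ) → d ≥ 2 → (ε : ℚ) → 0ℚ < ε →
    Σ ℕ λ M →
    (p k q : ℕ) → Prime p → ¬ (p ≡ 2) → k ≥ 1 → q ≡ p ^ k → .{{_ : NonZero q}} →
    (F : FiniteField q) → (A : Subset q) → ∣ A ∣ ≥ M →
    ℕ→ℚ (sumSqN F d A)
    ≤ ((1ℚ + ε) *ℚ (ℕ→ℚ (∣ A ∣ ^ (2 * (d * d))) *ℚ ((+ 1) / q)))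
    + (ℕ→ℚ (q ^ (d ∸ 1) * ∣ A ∣ ^ (2 * d)) *ℚ (1ℚ + ε) *ℚ ℕ→ℚ (sumSqN F (d ∸ 1) A))
-- With ε = (e + 1) / (k + 1) in lowest terms, the threshold is (k + 1)(d - 1), which depends only
-- on d and the denominator of ε. The substitution identifies the quotient of numerator and
-- denominator with ε itself.
theorem8 (suc (suc m)) _ ε@(mkℚ (+ suc e) k _) _ = suc k * suc m , λ _ _ q _ _ _ _ F A M≤∣A∣ →
  subst (λ ε → ℕ→ℚ (sumSqN F (suc (suc m)) A)
      ≤ ((1ℚ + ε) *ℚ (ℕ→ℚ (∣ A ∣ ^ (2 * (suc (suc m) * suc (suc m)))) *ℚ ((+ 1) / q)))
      + (ℕ→ℚ (q ^ suc m * ∣ A ∣ ^ (2 * suc (suc m))) *ℚ (1ℚ + ε) *ℚ ℕ→ℚ (sumSqN F (suc m) A)))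
    (ℚ.↥p/↧p≡p ε) (ClearingDenominators.bound m k e q F A M≤∣A∣)
theorem8 1 (s≤s ()) _ _
theorem8 (suc (suc m)) _ (mkℚ (+ zero)  _ _) (ℚ.*<* (ℤ.+<+ ()))
theorem8 (suc (suc m)) _ (mkℚ -[1+ _ ] _ _) (ℚ.*<* ())
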